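{- Suppose that $R=R_1\times R_2$, where, for $i=1,2$, $R_i$ is an Artinian local ring with exactly $t_i\geq 2$ proper ideals and $t_i$ is (finite and) even. Then $\mathcal{EG}(R)$ is Class $2$ if and only if $t_1=t_2=2$.
   Context: All rings are commutative with identity. Proper ideals of a ring are the ideals different from the whole ring; the zero ideal is counted as a proper ideal (so $R_i$ has $t_i+1$ ideals in total). $A(R)$ is the set of ideals of $R$ with non-zero annihilator, and $A(R)^*=A(R)\setminus\{(0)\}$. A non-zero ideal $I$ of $R$ is essential, written $I\leq_e R$, if it has non-zero intersection with every non-zero ideal of $R$. The essential annihilating-ideal graph $\mathcal{EG}(R)$ is the simple graph with vertex set $A(R)^*$ in which two distinct vertices $I,J$ are adjacent if and only if $\mathrm{Ann}(IJ)\leq_e R$. For a graph $G$, $\Delta(G)$ is the maximum degree and $\chi'(G)$ the edge chromatic number (smallest number of colors in an edge coloring in which adjacent edges get different colors). $G$ is Class $2$ if $\chi'(G)=\Delta(G)+1$. -}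

module Defs where

open import Algebra.Bundles using (CommutativeRing)
open import Data.Fin.Base using (Fin)
open import Data.Nat.Base as ℕ using (ℕ; suc)
open import Data.Product.Base using (Σ; ∃; _×_; _,_; proj₁; proj₂)
open import Data.Sum.Base using (_⊎_)
open import Data.Unit.Polymorphic.Base using (⊤)
open import Function.Base using (_∘_)
open import Function.Bundles using (Inverse)
open import Level using (Level; _⊔_; Lift; lift; lower) renaming (suc to lsuc)
open import Relation.Binary.Bundles using (Setoid)
open import Relation.Binary.Core using (Rel)
open import Relation.Binary.Definitions using (Symmetric; Irreflexive)
import Relation.Binary.Construct.On as On
open import Relation.Binary.PropositionalEquality.Core using (_≡_; _≢_)
open import Relation.Binary.PropositionalEquality.Properties using (setoid)
open import Relation.Nullary.Negation.Core using (¬_)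
open import Relation.Unary using (Pred; _⊆_; _≐_; _∩_)
open import Relation.Unary.Properties using (≐-refl; ≐-sym; ≐-trans)

HasSize : ∀ {a e} → Setoid a e → ℕ → Set (a ⊔ e)
HasSize S n = Inverse (setoid (Fin n)) S

------------------------------------------------------------------------
-- Simple graphs on a setoid of vertices

record SimpleGraph (v e a : Level) : Set (lsuc (v ⊔ e ⊔ a)) where
  field
    vertices : Setoid v e
  open Setoid vertices public
    using () renaming (Carrier to V; _≈_ to _≈ᵛ_)
  field
    _~_      : Rel V a
    ~-sym    : Symmetric _~_
    ~-irrefl : Irreflexive _≈ᵛ_ _~_
    ~-resp   : ∀ {x x′ y y′} → x ≈ᵛ x′ → y ≈ᵛ y′ → x ~ y → x′ ~ y′

module _ {v e a} (G : SimpleGraph v e a) where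
  open SimpleGraph G

  Neighbours : V → Setoid (v ⊔ a) e
  Neighbours x = On.setoid {B = Σ V (x ~_)} vertices proj₁

  HasDegree : V → ℕ → Set (v ⊔ e ⊔ a)
  HasDegree x d = HasSize (Neighbours x) d

  IsMaxDegree : ℕ → Set (v ⊔ e ⊔ a)
  IsMaxDegree Δ = (∀ x → ∃ λ d → HasDegree x d × d ℕ.≤ Δ)
                × (∃ λ x → HasDegree x Δ)

  -- `colour-cong` and `colour-sym` make `colour` a function of the
  -- unoriented edge, independent of the adjacency proof and of the
  -- representatives of the endpoints.
  record EdgeColouring (k : ℕ) : Set (v ⊔ e ⊔ a) where
    field
      colour      : ∀ {x y} → x ~ y → Fin k
      colour-cong : ∀ {x x′ y y′} → x ≈ᵛ x′ → y ≈ᵛ y′ →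
                    (p : x ~ y) (q : x′ ~ y′) → colour p ≡ colour q
      colour-sym  : ∀ {x y} (p : x ~ y) → colour (~-sym p) ≡ colour p
      proper      : ∀ {x y z} (p : x ~ y) (q : x ~ z) →
                    ¬ (y ≈ᵛ z) → colour p ≢ colour q

  IsChromaticIndex : ℕ → Set (v ⊔ e ⊔ a)
  IsChromaticIndex k = EdgeColouring k × (∀ j → EdgeColouring j → k ℕ.≤ j)

  Class2 : Set (v ⊔ e ⊔ a)
  Class2 = ∃ λ Δ → IsMaxDegree Δ × IsChromaticIndex (suc Δ)

------------------------------------------------------------------------
-- Ideals of a commutative ring

module _ {c ℓ} (R : CommutativeRing c ℓ) where
  open CommutativeRing R

  -- Membership lives in the level c ⊔ ℓ, so that principal ideals,
  -- annihilators and products of ideals are again of this form.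
  record Ideal : Set (lsuc (c ⊔ ℓ)) where
    field
      member   : Pred Carrier (c ⊔ ℓ)
      resp     : ∀ {x y} → x ≈ y → member x → member y
      0#∈      : member 0#
      +-closed : ∀ {x y} → member x → member y → member (x + y)
      *-closed : ∀ r {x} → member x → member (r * x)

module _ {c ℓ} {R : CommutativeRing c ℓ} where
  open CommutativeRing R
  open Ideal

  infix 4 _⊆ᴵ_ _≈ᴵ_ _≤ₑR
  infixl 7 _·ᴵ_ _∩ᴵ_

  _⊆ᴵ_ _≈ᴵ_ : Rel (Ideal R) (c ⊔ ℓ)
  I ⊆ᴵ J = member I ⊆ member J
  I ≈ᴵ J = member I ≐ member J

  0ᴵ : Ideal R
  0ᴵ = record
    { member   = λ x → Lift c (x ≈ 0#)
    ; resp     = λ x≈y (lift x≈0) → lift (trans (sym x≈y) x≈0)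
    ; 0#∈      = lift refl
    ; +-closed = λ (lift p) (lift q) → lift (trans (+-cong p q) (+-identityˡ 0#))
    ; *-closed = λ r (lift p) → lift (trans (*-congˡ p) (zeroʳ r))
    }

  1ᴵ : Ideal R
  1ᴵ = record { member = λ _ → ⊤ }

  _∩ᴵ_ : Ideal R → Ideal R → Ideal R
  I ∩ᴵ J = record
    { member   = member I ∩ member J
    ; resp     = λ x≈y (p , q) → resp I x≈y p , resp J x≈y q
    ; 0#∈      = 0#∈ I , 0#∈ J
    ; +-closed = λ (p , q) (p′ , q′) → +-closed I p p′ , +-closed J q q′
    ; *-closed = λ r (p , q) → *-closed I r p , *-closed J r q
    }

  -- The finite sums of products a * b with a ∈ I and b ∈ J.
  data ProductMember (I J : Ideal R) : Pred Carrier (c ⊔ ℓ) where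
    empty : ∀ {x} → x ≈ 0# → ProductMember I J x
    add   : ∀ {x y a b} → member I a → member J b → ProductMember I J y →
            x ≈ a * b + y → ProductMember I J x

  private
    product-resp : ∀ {I J x y} → x ≈ y → ProductMember I J x → ProductMember I J y
    product-resp x≈y (empty p)     = empty (trans (sym x≈y) p)
    product-resp x≈y (add i j s p) = add i j s (trans (sym x≈y) p)

    product-+ : ∀ {I J x y} → ProductMember I J x → ProductMember I J y →
                ProductMember I J (x + y)
    product-+ (empty p) t =
      product-resp (trans (sym (+-identityˡ _)) (+-congʳ (sym p))) t
    product-+ (add i j s p) t =
      add i j (product-+ s t) (trans (+-congʳ p) (+-assoc _ _ _))

    product-* : ∀ {I J} r {x} → ProductMember I J x → ProductMember I J (r * x)
    product-* r (empty p) = empty (trans (*-congˡ p) (zeroʳ r))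
    product-* {I} r (add i j s p) =
      add (*-closed I r i) j (product-* r s)
        (trans (*-congˡ p) (trans (distribˡ r _ _) (+-congʳ (sym (*-assoc r _ _)))))

    product-mono : ∀ {I I′ J J′} → I ⊆ᴵ I′ → J ⊆ᴵ J′ →
                   ProductMember I J ⊆ ProductMember I′ J′
    product-mono f g (empty p)     = empty p
    product-mono f g (add i j s p) = add (f i) (g j) (product-mono f g s) p

    product-comm : ∀ {I J} → ProductMember I J ⊆ ProductMember J I
    product-comm (empty p)     = empty p
    product-comm (add i j s p) =
      add j i (product-comm s) (trans p (+-congʳ (*-comm _ _)))

  _·ᴵ_ : Ideal R → Ideal R → Ideal R
  I ·ᴵ J = record
    { member   = ProductMember I J
    ; resp     = product-resp
    ; 0#∈      = empty refl
    ; +-closed = product-+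
    ; *-closed = product-*
    }

  Ann : Ideal R → Ideal R
  Ann I = record
    { member   = λ x → ∀ {y} → member I y → x * y ≈ 0#
    ; resp     = λ x≈x′ p i → trans (*-congʳ (sym x≈x′)) (p i)
    ; 0#∈      = λ _ → zeroˡ _
    ; +-closed = λ p q i →
        trans (distribʳ _ _ _) (trans (+-cong (p i) (q i)) (+-identityˡ 0#))
    ; *-closed = λ r p i → trans (*-assoc r _ _) (trans (*-congˡ (p i)) (zeroʳ r))
    }

  IsNonZero : Ideal R → Set (c ⊔ ℓ)
  IsNonZero I = ¬ (I ≈ᴵ 0ᴵ)

  IsProper : Ideal R → Set (c ⊔ ℓ)
  IsProper I = ¬ (I ≈ᴵ 1ᴵ)

  _≤ₑR : Ideal R → Set (lsuc (c ⊔ ℓ))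
  I ≤ₑR = IsNonZero I × (∀ J → IsNonZero J → IsNonZero (I ∩ᴵ J))

  -- A maximal ideal M decides every proposition P : Set (c ⊔ ℓ): take
  -- J = M + { x ∣ P }.  So results on local rings hold classically at this
  -- level without a separate excluded-middle hypothesis.
  IsMaximal : Ideal R → Set (lsuc (c ⊔ ℓ))
  IsMaximal M = IsProper M × (∀ J → M ⊆ᴵ J → (J ≈ᴵ M) ⊎ (J ≈ᴵ 1ᴵ))

  private
    ≤ₑR-mono : ∀ {I J} → I ⊆ᴵ J → I ≤ₑR → J ≤ₑR
    ≤ₑR-mono {I} {J} I⊆J (I≠0 , ess) =
        (λ (J⊆0 , _) → I≠0 ((λ i → J⊆0 (I⊆J i)) , λ (lift p) → resp I (sym p) (0#∈ I)))
      , λ K K≠0 (J∩K⊆0 , _) → ess K K≠0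
          ( (λ (i , k) → J∩K⊆0 (I⊆J i , k))
          , λ (lift p) → resp I (sym p) (0#∈ I) , resp K (sym p) (0#∈ K))

    Ann-anti : ∀ {I J} → I ⊆ᴵ J → Ann J ⊆ᴵ Ann I
    Ann-anti I⊆J p i = p (I⊆J i)

  adj-sym : ∀ {I J} → Ann (I ·ᴵ J) ≤ₑR → Ann (J ·ᴵ I) ≤ₑR
  adj-sym {I} {J} = ≤ₑR-mono {Ann (I ·ᴵ J)} {Ann (J ·ᴵ I)}
    (Ann-anti {J ·ᴵ I} {I ·ᴵ J} product-comm)

  adj-resp : ∀ {I I′ J J′} → I ≈ᴵ I′ → J ≈ᴵ J′ →
             Ann (I ·ᴵ J) ≤ₑR → Ann (I′ ·ᴵ J′) ≤ₑR
  adj-resp {I} {I′} {J} {J′} (_ , I′⊆I) (_ , J′⊆J) =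
    ≤ₑR-mono {Ann (I ·ᴵ J)} {Ann (I′ ·ᴵ J′)} (Ann-anti {I′ ·ᴵ J′} {I ·ᴵ J}
      (product-mono {I′} {I} {J′} {J} I′⊆I J′⊆J))

module _ {c ℓ} (R : CommutativeRing c ℓ) where

  idealSetoid : Setoid (lsuc (c ⊔ ℓ)) (c ⊔ ℓ)
  idealSetoid = record
    { Carrier       = Ideal R
    ; _≈_           = _≈ᴵ_
    ; isEquivalence = record { refl = ≐-refl ; sym = ≐-sym ; trans = ≐-trans }
    }

  properIdealSetoid : Setoid (lsuc (c ⊔ ℓ)) (c ⊔ ℓ)
  properIdealSetoid = On.setoid {B = Σ (Ideal R) IsProper} idealSetoid proj₁

  IsArtinian : Set (lsuc (c ⊔ ℓ))
  IsArtinian = (I : ℕ → Ideal R) → (∀ n → I (suc n) ⊆ᴵ I n) →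
               ∃ λ N → ∀ n → N ℕ.≤ n → I n ≈ᴵ I N

  IsLocal : Set (lsuc (c ⊔ ℓ))
  IsLocal = ∃ λ (M : Ideal R) → IsMaximal M × (∀ N → IsMaximal N → N ≈ᴵ M)

  -- A(R)*
  annihilatingIdealSetoid : Setoid (lsuc (c ⊔ ℓ)) (c ⊔ ℓ)
  annihilatingIdealSetoid =
    On.setoid {B = Σ (Ideal R) λ I → IsNonZero (Ann I) × IsNonZero I}
      idealSetoid proj₁

  -- The essential annihilating-ideal graph
  𝓔𝓖 : SimpleGraph (lsuc (c ⊔ ℓ)) (c ⊔ ℓ) (lsuc (c ⊔ ℓ))
  𝓔𝓖 = record
    { vertices = annihilatingIdealSetoid
    ; _~_      = λ (I , _) (J , _) → ¬ (I ≈ᴵ J) × (Ann (I ·ᴵ J) ≤ₑR)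
    ; ~-sym    = λ {(I , _)} {(J , _)} (I≉J , e) → (I≉J ∘ ≐-sym) , adj-sym {I = I} {J} e
    ; ~-irrefl = λ I≈J (I≉J , _) → I≉J I≈J
    ; ~-resp   = λ {(I , _)} {(I′ , _)} {(J , _)} {(J′ , _)} I≈I′ J≈J′ (I≉J , e) →
        (λ I′≈J′ → I≉J (≐-trans I≈I′ (≐-trans I′≈J′ (≐-sym J≈J′))))
        , adj-resp {I = I} {I′} {J} {J′} I≈I′ J≈J′ e
    }

{-
An ideal of R₁ × R₂ is I₁ × I₂, and Ann (I J) is essential iff both factors of
I J are proper.  So the graph is the join of a complete graph on the
t₁ t₂ - 1 ideals with both factors proper and the complete bipartite graph
between the t₁ ideals I₁ × R₂ and the t₂ ideals R₁ × I₂.  It has an odd number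
2m + 1 of vertices and maximum degree 2m.

For t₁ = t₂ = 2 it is overfull: 19 edges, while 6 matchings on 7 vertices have
at most 18 edges.

Otherwise place the vertices on Walecki's decomposition of the complete graph
into m Hamilton cycles so that every cycle contains a missing edge, that is, two
ideals I₁ × R₂ and J₁ × R₂, or two ideals R₁ × I₂ and R₁ × J₂.  What is left of
each cycle is 2-colourable, which makes 2m colours.  Cycles are indexed by sums
of labels, so such a placement needs two sets of sizes t₁ and t₂ whose sums of
two distinct elements together cover ℤ/m.
-}

module Submission where

open import Algebra.Bundles using (CommutativeRing)
open import Algebra.Construct.DirectProduct using (commutativeRing)
import Algebra.Properties.CommutativeMonoid.Sum as Sum
import Algebra.Properties.Ring
open import Data.Empty using (⊥)
open import Data.Fin.Base as Fin using (Fin; zero; suc; toℕ; fromℕ<)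
import Data.Fin.Permutation as Perm
import Data.Fin.Properties as Fin
open import Data.Maybe.Base using (Maybe; just; nothing)
open import Data.Nat.Base using (ℕ; zero; suc; _≤_)
import Data.Nat.Properties as ℕ
open import Data.Nat.Divisibility.Core using (_∣_; divides)
open import Data.Product.Base using (∃; ∃₂; Σ; _×_; _,_; proj₁; proj₂)
open import Data.Sum.Base as Sum⊎ using (_⊎_; inj₁; inj₂; [_,_]; swap)
import Data.Unit.Base as Unit
open import Data.Unit.Polymorphic.Base using (tt)
open import Function.Base using (_∘_; id)
open import Function.Bundles using (Inverse; _⇔_; mk⇔)
import Function.Construct.Composition as Composition
import Function.Construct.Symmetry as Symmetry
open import Function.Definitions using (Injective)
open import Level using (Level; _⊔_; Lift; lift; lower)
open import Relation.Binary.Bundles using (Setoid)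
open import Relation.Binary.Definitions using (tri<; tri≈; tri>)
open import Relation.Binary.PropositionalEquality.Core as ≡ using (_≡_; _≢_)
open import Relation.Nullary using (¬_; Dec; yes; no; contradiction; decidable-stable)
open import Relation.Unary using (Decidable)
open import Relation.Unary.Properties using (≐-sym; ≐-trans)
open import Defs

-- Local rings with finitely many ideals

-- Essentiality of annihilators rests on one fact about an Artinian local ring: a proper ideal K
-- annihilates a non-zero element of every non-zero ideal. No nilpotency of the maximal ideal is
-- needed; a stationary chain of principal ideals suffices.
--
-- The obstacle in the placement is that labels must stay distinct modulo 2m while pair sums reach
-- all m cycles. Even labels 2x for one class and odd labels 2y + o for the other keep the classes
-- apart at no cost, and every pair sum within a class is even, with half x + x′ or y + y′ + o as
-- the index of its cycle. Hence one class has to cover 1, ..., o and the other an interval of m - o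
-- sums, shifted by o.
--
-- Let t₁ = 2u and t₂ = 2v, so that m = 2uv + u + v - 1. The sets used have pair sums 1, ..., u² +
-- 2u - 2 and 1, ..., v² + 2v - 2. Together these exceed m by (u - v)² + u + v - 3, which is
-- positive except for u = v = 1, exactly the overfull case. Oddness of o may waste one sum, and a
-- surplus of one pays for it.

Classical : (c ℓ : Level) → Set _
Classical c ℓ = (P : Set (c ⊔ ℓ)) → Dec P

module _ {c ℓ} {R : CommutativeRing c ℓ} where
  open CommutativeRing R hiding (zero)
  open Ideal

  1∈⇒≈1ᴵ : (I : Ideal R) → member I 1# → I ≈ᴵ 1ᴵ
  1∈⇒≈1ᴵ I 1∈I = (λ _ → tt) , λ {x} _ → resp I (*-identityʳ x) (*-closed I x 1∈I)

  maximal⇒classical : (M : Ideal R) → IsMaximal M → Classical c ℓ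
  maximal⇒classical M (M-proper , M-max) P = decide (M-max J inj₁)
    where
    J : Ideal R
    J = record
      { member   = λ x → member M x ⊎ P
      ; resp     = λ { x≈y (inj₁ x∈M) → inj₁ (resp M x≈y x∈M) ; _ (inj₂ p) → inj₂ p }
      ; 0#∈      = inj₁ (0#∈ M)
      ; +-closed = λ { (inj₂ p) _ → inj₂ p ; _ (inj₂ p) → inj₂ p
                     ; (inj₁ x∈M) (inj₁ y∈M) → inj₁ (+-closed M x∈M y∈M) }
      ; *-closed = λ { r (inj₁ x∈M) → inj₁ (*-closed M r x∈M) ; _ (inj₂ p) → inj₂ p }
      }
    decide : (J ≈ᴵ M) ⊎ (J ≈ᴵ 1ᴵ) → Dec P
    decide (inj₁ (J⊆M , _)) = no λ p → M-proper (1∈⇒≈1ᴵ M (J⊆M (inj₂ p)))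
    decide (inj₂ (_ , 1⊆J)) with 1⊆J {1#} tt
    ... | inj₁ 1∈M = contradiction (1∈⇒≈1ᴵ M 1∈M) M-proper
    ... | inj₂ p   = yes p

  ⟨_⟩ : Carrier → Ideal R
  ⟨ x ⟩ = record
    { member   = λ y → ∃ λ r → y ≈ r * x
    ; resp     = λ y≈z (r , e) → r , trans (sym y≈z) e
    ; 0#∈      = 0# , sym (zeroˡ x)
    ; +-closed = λ (r , e) (s , f) → r + s , trans (+-cong e f) (sym (distribʳ x r s))
    ; *-closed = λ q (r , e) → q * r , trans (*-congˡ e) (sym (*-assoc q r x))
    }

  ·ᴵ-⊆ˡ : (I J : Ideal R) → I ·ᴵ J ⊆ᴵ I
  ·ᴵ-⊆ˡ I J (empty x≈0) = resp I (sym x≈0) (0#∈ I)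
  ·ᴵ-⊆ˡ I J (add {b = b} a∈I _ s e) = resp I (sym e)
    (+-closed I (resp I (*-comm b _) (*-closed I b a∈I)) (·ᴵ-⊆ˡ I J s))

  ·ᴵ-⊆ʳ : (I J : Ideal R) → I ·ᴵ J ⊆ᴵ J
  ·ᴵ-⊆ʳ I J (empty x≈0) = resp J (sym x≈0) (0#∈ J)
  ·ᴵ-⊆ʳ I J (add {a = a} _ b∈J s e) = resp J (sym e) (+-closed J (*-closed J a b∈J) (·ᴵ-⊆ʳ I J s))

  ⊆0ᴵ⇒≈0ᴵ : (I : Ideal R) → I ⊆ᴵ 0ᴵ → I ≈ᴵ 0ᴵ
  ⊆0ᴵ⇒≈0ᴵ I I⊆0 = I⊆0 , λ (lift x≈0) → resp I (sym x≈0) (0#∈ I)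

module FiniteLocal {c ℓ} (R : CommutativeRing c ℓ) (artinian : IsArtinian R) (local : IsLocal R)
                   {t} (size : HasSize (properIdealSetoid R) t) where
  open CommutativeRing R hiding (zero)
  open Ideal
  open Inverse size using (to; from; strictlyInverseˡ; strictlyInverseʳ; from-cong)

  M : Ideal R
  M = proj₁ local

  M-proper : IsProper M
  M-proper = proj₁ (proj₁ (proj₂ local))

  classical : Classical c ℓ
  classical = maximal⇒classical M (proj₁ (proj₂ local))

  ProperIdeal : Set _
  ProperIdeal = Σ (Ideal R) IsProper

  -- One pass through the list is enough: an entry rejected because it does not contain the current
  -- ideal cannot contain the larger final one either.
  enlarge : ∀ k (f : Fin k → ProperIdeal) (I : ProperIdeal) →
            Σ ProperIdeal λ J → proj₁ I ⊆ᴵ proj₁ J × (∀ i → proj₁ J ⊆ᴵ proj₁ (f i) → proj₁ (f i) ⊆ᴵ proj₁ J)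
  enlarge zero    f I = I , id , λ ()
  enlarge (suc k) f I with classical (proj₁ I ⊆ᴵ proj₁ (f zero))
  ... | yes I⊆f₀ with enlarge k (f ∘ suc) (f zero)
  ... | J , f₀⊆J , J-max = J , f₀⊆J ∘ I⊆f₀ , λ { zero _ → f₀⊆J ; (suc i) → J-max i }
  enlarge (suc k) f I | no I⊈f₀ with enlarge k (f ∘ suc) I
  ... | J , I⊆J , J-max = J , I⊆J ,
    λ { zero J⊆f₀ → contradiction (λ {x} x∈I → J⊆f₀ (I⊆J x∈I)) I⊈f₀ ; (suc i) → J-max i }

  -- With finitely many proper ideals, `enlarge` takes the place of Zorn's lemma; the enlarged ideal
  -- is maximal, hence equal to `M` by uniqueness.
  proper⊆M : (I : Ideal R) → IsProper I → I ⊆ᴵ M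
  proper⊆M I I-proper with enlarge t to (I , I-proper)
  ... | (J , J-proper) , I⊆J , J-max = λ x∈I → proj₁ J≈M (I⊆J x∈I)
    where
    J-maximal : IsMaximal J
    J-maximal = J-proper , λ K J⊆K → case K J⊆K (classical (K ≈ᴵ 1ᴵ))
      where
      case : ∀ K → J ⊆ᴵ K → Dec (K ≈ᴵ 1ᴵ) → (K ≈ᴵ J) ⊎ (K ≈ᴵ 1ᴵ)
      case K J⊆K (yes K≈1)     = inj₂ K≈1
      case K J⊆K (no K-proper) = inj₁ ((λ x∈K → J-max i (λ x∈J → proj₂ e (J⊆K x∈J)) (proj₂ e x∈K)) , J⊆K)
        where
        i = from (K , K-proper)
        e : proj₁ (to i) ≈ᴵ K
        e = strictlyInverseˡ (K , K-proper)
    J≈M : J ≈ᴵ M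
    J≈M = proj₂ (proj₂ local) J J-maximal

  1≉0 : ¬ 1# ≈ 0#
  1≉0 1≈0 = M-proper (1∈⇒≈1ᴵ M (resp M (sym 1≈0) (0#∈ M)))

  NonZeroIn : Ideal R → Set _
  NonZeroIn I = ∃ λ x → member I x × ¬ x ≈ 0#

  nonZero⇒∃ : (I : Ideal R) → IsNonZero I → NonZeroIn I
  nonZero⇒∃ I I≠0 with classical (NonZeroIn I)
  ... | yes p = p
  ... | no ¬p = contradiction (⊆0ᴵ⇒≈0ᴵ I λ {x} x∈I →
    decidable-stable (classical (Lift c (x ≈ 0#))) λ x≉0 → ¬p (x , x∈I , x≉0 ∘ lift)) I≠0

  -- Otherwise Ann ⟨ x ⟩ is proper and contains 1 - e, so 1 = (1 - e) + e lies in M.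
  proper-fixes-only-0 : ∀ K → IsProper K → ∀ {x e} → member K e → x ≈ e * x → x ≈ 0#
  proper-fixes-only-0 K K-proper {x} {e} e∈K x≈ex =
    lower (decidable-stable (classical (Lift c (x ≈ 0#))) λ x≉0 →
      M-proper (1∈⇒≈1ᴵ M (resp M 1-e+e≈1 (+-closed M
        (proper⊆M (Ann ⟨ x ⟩)
          (λ (_ , 1⊆Ann) → x≉0 (lift (trans (sym (*-identityˡ x)) (1⊆Ann {1#} tt (1# , sym (*-identityˡ x))))))
          annihilates)
        (proper⊆M K K-proper e∈K)))))
    where
    open import Relation.Binary.Reasoning.Setoid setoid
    open Algebra.Properties.Ring ring using (-‿distribˡ-*)
    1-e+e≈1 : 1# + - e + e ≈ 1#
    1-e+e≈1 = trans (+-assoc 1# (- e) e) (trans (+-congˡ (-‿inverseˡ e)) (+-identityʳ 1#))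
    [1-e]x≈0 : (1# + - e) * x ≈ 0#
    [1-e]x≈0 = begin
      (1# + - e) * x     ≈⟨ distribʳ x 1# (- e) ⟩
      1# * x + - e * x   ≈⟨ +-cong (*-identityˡ x) (sym (-‿distribˡ-* e x)) ⟩
      x + - (e * x)      ≈⟨ +-congˡ (-‿cong x≈ex) ⟨
      x + - x            ≈⟨ -‿inverseʳ x ⟩
      0#                 ∎
    annihilates : member (Ann {R = R} ⟨ x ⟩) (1# + - e)
    annihilates {y} (r , y≈rx) = begin
      (1# + - e) * y        ≈⟨ *-congˡ y≈rx ⟩
      (1# + - e) * (r * x)  ≈⟨ *-congˡ (*-comm r x) ⟩
      (1# + - e) * (x * r)  ≈⟨ *-assoc _ x r ⟨
      (1# + - e) * x * r    ≈⟨ *-congʳ [1-e]x≈0 ⟩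
      0# * r                ≈⟨ zeroˡ r ⟩
      0#                    ∎

  -- Otherwise multiplication by elements of K never kills the non-zero
  -- elements of J, and the resulting descending chain of principal ideals stops.
  proper⇒Ann-meets : ∀ K → IsProper K → ∀ J → IsNonZero J → IsNonZero (Ann K ∩ᴵ J)
  proper⇒Ann-meets K K-proper J J≠0 (meet⊆0 , _) =
    -- Where the chain stops, the `N`-th term `x` satisfies `x = r * (x * k)` with `k` in `K`, so
    -- `e = r * k` lies in `K` and fixes `x`.
    proj₂ (proj₂ (sequence N)) (proper-fixes-only-0 K K-proper
      (*-closed K (proj₁ stops) (proj₁ (proj₂ (factor (sequence N)))))
      (trans (proj₂ stops) (trans (*-congˡ (*-comm _ _)) (sym (*-assoc _ _ _)))))
    where
    factor : (s : NonZeroIn J) → ∃ λ k → member K k × ¬ proj₁ s * k ≈ 0#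
    factor (x , x∈J , x≉0) with classical (∃ λ k → member K k × ¬ x * k ≈ 0#)
    ... | yes p = p
    ... | no ¬p = contradiction (lower (meet⊆0 (x∈Ann , x∈J))) x≉0
      where
      x∈Ann : member (Ann K) x
      x∈Ann {k} k∈K = lower (decidable-stable (classical (Lift c (x * k ≈ 0#)))
        λ xk≉0 → ¬p (k , k∈K , xk≉0 ∘ lift))
    step : NonZeroIn J → NonZeroIn J
    step s@(x , x∈J , _) = let k , _ , xk≉0 = factor s in
      x * k , resp J (*-comm k x) (*-closed J k x∈J) , xk≉0
    sequence : ℕ → NonZeroIn J
    sequence zero    = nonZero⇒∃ J J≠0
    sequence (suc n) = step (sequence n)
    chain : ℕ → Ideal R
    chain n = ⟨ proj₁ (sequence n) ⟩
    descends : ∀ n → chain (suc n) ⊆ᴵ chain n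
    descends n (r , e) = r * k , trans e (trans (*-congˡ (*-comm _ k)) (sym (*-assoc r k _)))
      where k = proj₁ (factor (sequence n))
    N = proj₁ (artinian chain descends)
    stops : member (chain (suc N)) (proj₁ (sequence N))
    stops = proj₂ (proj₂ (artinian chain descends) (suc N) (ℕ.n≤1+n N)) (1# , sym (*-identityˡ _))

  -- `nothing` stands for the unit ideal, so that all ideals, proper or not, have codes in a type
  -- with decidable equality.
  code : Ideal R → Maybe (Fin t)
  code I with classical (I ≈ᴵ 1ᴵ)
  ... | yes _       = nothing
  ... | no I-proper = just (from (I , I-proper))

  decode : Maybe (Fin t) → Ideal R
  decode nothing  = 1ᴵ
  decode (just i) = proj₁ (to i)

  decode-code : (I : Ideal R) → decode (code I) ≈ᴵ I
  decode-code I with classical (I ≈ᴵ 1ᴵ)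
  ... | yes (I⊆1 , 1⊆I) = 1⊆I , I⊆1
  ... | no I-proper     = strictlyInverseˡ (I , I-proper)

  code≡nothing : {I : Ideal R} → I ≈ᴵ 1ᴵ → code I ≡ nothing
  code≡nothing {I} I≈1 with classical (I ≈ᴵ 1ᴵ)
  ... | yes _       = ≡.refl
  ... | no I-proper = contradiction I≈1 I-proper

  code≡nothing⁻¹ : {I : Ideal R} → code I ≡ nothing → I ≈ᴵ 1ᴵ
  code≡nothing⁻¹ {I} eq with classical (I ≈ᴵ 1ᴵ)
  code≡nothing⁻¹ {I} eq | yes I≈1 = I≈1
  code≡nothing⁻¹ {I} () | no _

  code≡just : (I : ProperIdeal) → code (proj₁ I) ≡ just (from I)
  code≡just (I , I-proper) with classical (I ≈ᴵ 1ᴵ)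
  ... | yes I≈1 = contradiction I≈1 I-proper
  ... | no _    = ≡.cong just (from-cong (id , id))

  code-cong : {I J : Ideal R} → I ≈ᴵ J → code I ≡ code J
  code-cong {I} {J} I≈J with classical (I ≈ᴵ 1ᴵ) | classical (J ≈ᴵ 1ᴵ)
  ... | yes _   | yes _   = ≡.refl
  ... | yes I≈1 | no J≉1  = contradiction (≐-trans (≐-sym I≈J) I≈1) J≉1
  ... | no I≉1  | yes J≈1 = contradiction (≐-trans I≈J J≈1) I≉1
  ... | no _    | no _    = ≡.cong just (from-cong I≈J)

  code-injective : {I J : Ideal R} → code I ≡ code J → I ≈ᴵ J
  code-injective {I} {J} eq = ≐-trans (≐-sym (decode-code I))
    (≡.subst (λ i → decode i ≈ᴵ J) (≡.sym eq) (decode-code J))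

  code-decode : ∀ i → code (decode i) ≡ i
  code-decode nothing  = code≡nothing {1ᴵ} (id , id)
  code-decode (just i) = ≡.trans (code≡just (to i)) (≡.cong just (strictlyInverseʳ i))

  0ᴵ-proper : IsProper (0ᴵ {R = R})
  0ᴵ-proper (_ , 1⊆0) = 1≉0 (lower (1⊆0 {1#} tt))

  0-code : Fin t
  0-code = from (0ᴵ , 0ᴵ-proper)

  code-0ᴵ : code 0ᴵ ≡ just 0-code
  code-0ᴵ = code≡just (0ᴵ , 0ᴵ-proper)

-- Ideals of a product

module Product {c ℓ} (R₁ R₂ : CommutativeRing c ℓ) where
  private
    module R₁ = CommutativeRing R₁
    module R₂ = CommutativeRing R₂
  open Ideal

  R : CommutativeRing c ℓ
  R = commutativeRing R₁ R₂

  private module R = CommutativeRing R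

  -- The slice through 0 agrees with the projection, because multiplying by the idempotent (1 , 0)
  -- moves every element of the ideal into the slice; membership in the slice needs no existential.
  factorˡ : Ideal R → Ideal R₁
  factorˡ I = record
    { member   = λ x → member I (x , R₂.0#)
    ; resp     = λ x≈y → resp I (x≈y , R₂.refl)
    ; 0#∈      = 0#∈ I
    ; +-closed = λ p q → resp I (R₁.refl , R₂.+-identityˡ _) (+-closed I p q)
    ; *-closed = λ r p → resp I (R₁.refl , R₂.zeroˡ _) (*-closed I (r , R₂.0#) p)
    }

  factorʳ : Ideal R → Ideal R₂
  factorʳ I = record
    { member   = λ y → member I (R₁.0# , y)
    ; resp     = λ x≈y → resp I (R₁.refl , x≈y)
    ; 0#∈      = 0#∈ I
    ; +-closed = λ p q → resp I (R₁.+-identityˡ _ , R₂.refl) (+-closed I p q)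
    ; *-closed = λ r p → resp I (R₁.zeroˡ _ , R₂.refl) (*-closed I (R₁.0# , r) p)
    }

  infixr 8 _×ᴵ_
  _×ᴵ_ : Ideal R₁ → Ideal R₂ → Ideal R
  I ×ᴵ J = record
    { member   = λ (x , y) → member I x × member J y
    ; resp     = λ (e , f) (p , q) → resp I e p , resp J f q
    ; 0#∈      = 0#∈ I , 0#∈ J
    ; +-closed = λ (p , q) (p′ , q′) → +-closed I p p′ , +-closed J q q′
    ; *-closed = λ (r , s) (p , q) → *-closed I r p , *-closed J s q
    }

  factorˡ-× : ∀ I J → factorˡ (I ×ᴵ J) ≈ᴵ I
  factorˡ-× I J = proj₁ , λ p → p , 0#∈ J

  factorʳ-× : ∀ I J → factorʳ (I ×ᴵ J) ≈ᴵ J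
  factorʳ-× I J = proj₂ , λ p → 0#∈ I , p

  ∈-factorˡ : ∀ I {x y} → member I (x , y) → member (factorˡ I) x
  ∈-factorˡ I p = resp I (R₁.*-identityˡ _ , R₂.zeroˡ _) (*-closed I (R₁.1# , R₂.0#) p)

  ∈-factorʳ : ∀ I {x y} → member I (x , y) → member (factorʳ I) y
  ∈-factorʳ I p = resp I (R₁.zeroˡ _ , R₂.*-identityˡ _) (*-closed I (R₁.0# , R₂.1#) p)

  ∈-factors : ∀ I {x y} → member (factorˡ I) x → member (factorʳ I) y → member I (x , y)
  ∈-factors I p q = resp I (R₁.+-identityʳ _ , R₂.+-identityˡ _) (+-closed I p q)

  factors-mono : ∀ I J → factorˡ I ⊆ᴵ factorˡ J → factorʳ I ⊆ᴵ factorʳ J → I ⊆ᴵ J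
  factors-mono I J f g p = ∈-factors J (f (∈-factorˡ I p)) (g (∈-factorʳ I p))

  factors-injective : ∀ I J → factorˡ I ≈ᴵ factorˡ J → factorʳ I ≈ᴵ factorʳ J → I ≈ᴵ J
  factors-injective I J (f , f′) (g , g′) = factors-mono I J f g , factors-mono J I f′ g′

  factorˡ-nonZero : ∀ I → IsNonZero (factorˡ I) → IsNonZero I
  factorˡ-nonZero I ≠0 (I⊆0 , _) = ≠0 (⊆0ᴵ⇒≈0ᴵ (factorˡ I) λ p → lift (proj₁ (lower (I⊆0 p))))

  factorʳ-nonZero : ∀ I → IsNonZero (factorʳ I) → IsNonZero I
  factorʳ-nonZero I ≠0 (I⊆0 , _) = ≠0 (⊆0ᴵ⇒≈0ᴵ (factorʳ I) λ p → lift (proj₂ (lower (I⊆0 p))))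

  factors-zero : ∀ I → factorˡ I ≈ᴵ 0ᴵ → factorʳ I ≈ᴵ 0ᴵ → I ≈ᴵ 0ᴵ
  factors-zero I (f , _) (g , _) = ⊆0ᴵ⇒≈0ᴵ I λ p →
    lift (lower (f (∈-factorˡ I p)) , lower (g (∈-factorʳ I p)))

  Ann-factorˡ : ∀ K → Ann (factorˡ K) ⊆ᴵ factorˡ (Ann K)
  Ann-factorˡ K p q = p (∈-factorˡ K q) , R₂.zeroˡ _

  Ann-factorʳ : ∀ K → Ann (factorʳ K) ⊆ᴵ factorʳ (Ann K)
  Ann-factorʳ K p q = R₁.zeroˡ _ , p (∈-factorʳ K q)

  ·-factorˡ : ∀ I J → factorˡ I ≈ᴵ 1ᴵ → factorˡ J ≈ᴵ 1ᴵ → member (I ·ᴵ J) (R₁.1# , R₂.0#)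
  ·-factorˡ I J (_ , f) (_ , g) = add (f tt) (g tt) (empty R.refl)
    (R.trans (R₁.sym (R₁.*-identityˡ _) , R₂.sym (R₂.zeroˡ _)) (R.sym (R.+-identityʳ _)))

  ·-factorʳ : ∀ I J → factorʳ I ≈ᴵ 1ᴵ → factorʳ J ≈ᴵ 1ᴵ → member (I ·ᴵ J) (R₁.0# , R₂.1#)
  ·-factorʳ I J (_ , f) (_ , g) = add (f tt) (g tt) (empty R.refl)
    (R.trans (R₁.sym (R₁.zeroˡ _) , R₂.sym (R₂.*-identityˡ _)) (R.sym (R.+-identityʳ _)))

  -- Whatever annihilates (1 , 0) has first coordinate 0, so `Ann K` meets the non-zero ideal R₁ × 0
  -- only in 0.
  1∈Kˡ⇒¬essential : ¬ R₁.1# R₁.≈ R₁.0# → ∀ K → member K (R₁.1# , R₂.0#) → ¬ (Ann K ≤ₑR)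
  1∈Kˡ⇒¬essential 1≉0 K 1∈K (_ , meets) = meets (1ᴵ ×ᴵ 0ᴵ)
    (λ (⊆0 , _) → 1≉0 (proj₁ (lower (⊆0 {R₁.1# , R₂.0#} (tt , lift R₂.refl)))))
    (⊆0ᴵ⇒≈0ᴵ (Ann K ∩ᴵ 1ᴵ ×ᴵ 0ᴵ) λ (p , _ , lift y≈0) →
      lift (R₁.trans (R₁.sym (R₁.*-identityʳ _)) (proj₁ (p 1∈K)) , y≈0))

  1∈Kʳ⇒¬essential : ¬ R₂.1# R₂.≈ R₂.0# → ∀ K → member K (R₁.0# , R₂.1#) → ¬ (Ann K ≤ₑR)
  1∈Kʳ⇒¬essential 1≉0 K 1∈K (_ , meets) = meets (0ᴵ ×ᴵ 1ᴵ)
    (λ (⊆0 , _) → 1≉0 (proj₂ (lower (⊆0 {R₁.0# , R₂.1#} (lift R₁.refl , tt)))))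
    (⊆0ᴵ⇒≈0ᴵ (Ann K ∩ᴵ 0ᴵ ×ᴵ 1ᴵ) λ (p , lift x≈0 , _) →
      lift (x≈0 , R₂.trans (R₂.sym (R₂.*-identityʳ _)) (proj₂ (p 1∈K))))

module LocalProduct {c ℓ} (R₁ R₂ : CommutativeRing c ℓ) {s t : ℕ}
  (artinian₁ : IsArtinian R₁) (local₁ : IsLocal R₁) (size₁ : HasSize (properIdealSetoid R₁) s)
  (artinian₂ : IsArtinian R₂) (local₂ : IsLocal R₂) (size₂ : HasSize (properIdealSetoid R₂) t) where

  open Product R₁ R₂
  open Ideal
  module L₁ = FiniteLocal R₁ artinian₁ local₁ size₁
  module L₂ = FiniteLocal R₂ artinian₂ local₂ size₂

  Unitalˡ Unitalʳ : Ideal R → Set _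
  Unitalˡ I = factorˡ I ≈ᴵ 1ᴵ
  Unitalʳ I = factorʳ I ≈ᴵ 1ᴵ

  1ᴵ-nonZero₁ : IsNonZero (1ᴵ {R = R₁})
  1ᴵ-nonZero₁ (⊆0 , _) = L₁.1≉0 (lower (⊆0 {CommutativeRing.1# R₁} tt))

  1ᴵ-nonZero₂ : IsNonZero (1ᴵ {R = R₂})
  1ᴵ-nonZero₂ (⊆0 , _) = L₂.1≉0 (lower (⊆0 {CommutativeRing.1# R₂} tt))

  Ann-nonZeroˡ : ∀ K → ¬ Unitalˡ K → IsNonZero (Ann K)
  Ann-nonZeroˡ K proper = factorˡ-nonZero (Ann K) λ (⊆0 , _) →
    L₁.proper⇒Ann-meets (factorˡ K) proper 1ᴵ 1ᴵ-nonZero₁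
      (⊆0ᴵ⇒≈0ᴵ (Ann (factorˡ K) ∩ᴵ 1ᴵ) λ (p , _) → ⊆0 (Ann-factorˡ K p))

  Ann-nonZeroʳ : ∀ K → ¬ Unitalʳ K → IsNonZero (Ann K)
  Ann-nonZeroʳ K proper = factorʳ-nonZero (Ann K) λ (⊆0 , _) →
    L₂.proper⇒Ann-meets (factorʳ K) proper 1ᴵ 1ᴵ-nonZero₂
      (⊆0ᴵ⇒≈0ᴵ (Ann (factorʳ K) ∩ᴵ 1ᴵ) λ (p , _) → ⊆0 (Ann-factorʳ K p))

  Ann-zero : ∀ K → Unitalˡ K → Unitalʳ K → ¬ IsNonZero (Ann K)
  Ann-zero K (_ , f) (_ , g) ≠0 = ≠0 (⊆0ᴵ⇒≈0ᴵ (Ann K) λ p →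
    lift (R.trans (R.sym (R.*-identityʳ _)) (p (∈-factors K (f tt) (g tt)))))
    where module R = CommutativeRing R

  -- A non-zero ideal of the product has a non-zero factor, and on that side the local ring supplies
  -- a non-zero annihilating element inside it.
  essential : ∀ K → ¬ Unitalˡ K → ¬ Unitalʳ K → Ann K ≤ₑR
  essential K properˡ properʳ = Ann-nonZeroˡ K properˡ , meets
    where
    meets : ∀ J → IsNonZero J → IsNonZero (Ann K ∩ᴵ J)
    meets J J≠0 with L₁.classical (factorˡ J ≈ᴵ 0ᴵ)
    ... | no Jˡ≠0 = factorˡ-nonZero (Ann K ∩ᴵ J) λ (⊆0 , _) →
      L₁.proper⇒Ann-meets (factorˡ K) properˡ (factorˡ J) Jˡ≠0
        (⊆0ᴵ⇒≈0ᴵ (Ann (factorˡ K) ∩ᴵ factorˡ J) λ (p , q) → ⊆0 (Ann-factorˡ K p , q))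
    ... | yes Jˡ≈0 = factorʳ-nonZero (Ann K ∩ᴵ J) λ (⊆0 , _) →
      L₂.proper⇒Ann-meets (factorʳ K) properʳ (factorʳ J) (J≠0 ∘ factors-zero J Jˡ≈0)
        (⊆0ᴵ⇒≈0ᴵ (Ann (factorʳ K) ∩ᴵ factorʳ J) λ (p , q) → ⊆0 (Ann-factorʳ K p , q))

  essential⇒¬Unital : ∀ I J → Ann (I ·ᴵ J) ≤ₑR →
                      ¬ (Unitalˡ I × Unitalˡ J) × ¬ (Unitalʳ I × Unitalʳ J)
  essential⇒¬Unital I J e =
    (λ (f , g) → 1∈Kˡ⇒¬essential L₁.1≉0 (I ·ᴵ J) (·-factorˡ I J f g) e) ,
    (λ (f , g) → 1∈Kʳ⇒¬essential L₂.1≉0 (I ·ᴵ J) (·-factorʳ I J f g) e)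

  -- Since `I ·ᴵ J` lies in both `I` and `J`, one of its factors contains 1 only if the
  -- corresponding factors of `I` and `J` both do.
  ¬Unital⇒essential : ∀ I J → ¬ (Unitalˡ I × Unitalˡ J) → ¬ (Unitalʳ I × Unitalʳ J) →
                      Ann (I ·ᴵ J) ≤ₑR
  ¬Unital⇒essential I J ¬ˡ ¬ʳ = essential (I ·ᴵ J)
    (λ (_ , f) → ¬ˡ (1∈⇒≈1ᴵ (factorˡ I) (·ᴵ-⊆ˡ I J (f tt)) , 1∈⇒≈1ᴵ (factorˡ J) (·ᴵ-⊆ʳ I J (f tt))))
    (λ (_ , f) → ¬ʳ (1∈⇒≈1ᴵ (factorʳ I) (·ᴵ-⊆ˡ I J (f tt)) , 1∈⇒≈1ᴵ (factorʳ J) (·ᴵ-⊆ʳ I J (f tt))))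

-- Hamilton decompositions of complete graphs

open import Data.Nat.Base using (NonZero; _+_; _*_; _∸_; _<_; z≤n; s≤s; _⊓_)
open import Data.Nat.DivMod
open import Data.Nat.Properties
open import Data.Nat.Tactic.RingSolver using (solve-∀)
open import Relation.Binary.PropositionalEquality using (refl; sym; trans; cong; cong₂; subst; subst₂)
open import Relation.Binary.PropositionalEquality.Properties using (module ≡-Reasoning)

-- Parity and remainders

double : ∀ a → a + a ≡ 2 * a
double = solve-∀

odd≢even : ∀ a b → suc (a + a) ≢ b + b
odd≢even a b eq = even≢odd b a (trans (sym (double b)) (trans (sym eq) (cong suc (double a))))

+-self-injective : ∀ {a b} → a + a ≡ b + b → a ≡ b
+-self-injective {a} {b} eq = *-cancelˡ-≡ a b 2 (trans (sym (double a)) (trans eq (double b)))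

-- Adding `d = n ∸ c % n` completes the shift by `c` to a multiple of `n`, so the original residue
-- can be recovered from the shifted one.
%-+-cancelʳ : ∀ {a b n} c .{{_ : NonZero n}} → a < n → b < n → (a + c) % n ≡ (b + c) % n → a ≡ b
%-+-cancelʳ {a} {b} {n} c a<n b<n e = begin
  a                         ≡⟨ recover a<n ⟨
  ((a + c) % n + d) % n     ≡⟨ cong (λ z → (z + d) % n) e ⟩
  ((b + c) % n + d) % n     ≡⟨ recover b<n ⟩
  b                         ∎
  where
  open ≡-Reasoning
  r = c % n
  d = n ∸ r
  recover : ∀ {x} → x < n → ((x + c) % n + d) % n ≡ x
  recover {x} x<n = begin
    ((x + c) % n + d) % n      ≡⟨ cong (λ z → ((x + z) % n + d) % n) (m≡m%n+[m/n]*n c n) ⟩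
    ((x + (r + q * n)) % n + d) % n ≡⟨ cong (λ z → (z % n + d) % n) (+-assoc x r (q * n)) ⟨
    ((x + r + q * n) % n + d) % n ≡⟨ cong (λ z → (z + d) % n) ([m+kn]%n≡m%n (x + r) q n) ⟩
    ((x + r) % n + d) % n      ≡⟨ %-distribˡ-+ ((x + r) % n) d n ⟩
    ((x + r) % n % n + d % n) % n ≡⟨ cong (λ z → (z + d % n) % n) (m%n%n≡m%n (x + r) n) ⟩
    ((x + r) % n + d % n) % n  ≡⟨ %-distribˡ-+ (x + r) d n ⟨
    (x + r + d) % n            ≡⟨ cong (_% n) (+-assoc x r d) ⟩
    (x + (r + d)) % n          ≡⟨ cong (λ z → (x + z) % n) (m+[n∸m]≡n (<⇒≤ (m%n<n c n))) ⟩
    (x + n) % n                ≡⟨ [m+n]%n≡m%n x n ⟩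
    x % n                      ≡⟨ m<n⇒m%n≡m x<n ⟩
    x                          ∎
    where q = c / n

-- Walecki's decomposition of the complete graph on ℤ/2m ∪ {∞} into m
-- Hamilton cycles: cycle k is ∞, k, k+1, k−1, k+2, k−2, …, k+m, ∞, so a finite
-- edge {x, y} lies on it iff x + y is 2k or 2k+1.  The finite vertices of cycle k
-- are numbered in this order from 0, and pos k x is the number of x.
module Walecki (m′ : ℕ) where

  m n : ℕ
  m = suc m′
  n = m * 2

  n≡m+m : n ≡ m + m
  n≡m+m = trans (*-comm m 2) (sym (double m))

  m<n : m < n
  m<n = subst (m <_) (sym n≡m+m) (m<m+n m (s≤s z≤n))

  cycle : ℕ → ℕ → ℕ
  cycle x y = (x + y) % n / 2

  cycle<m : ∀ x y → cycle x y < m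
  cycle<m x y = m<n*o⇒m/o<n (m%n<n (x + y) n)

  offset : ℕ → ℕ → ℕ
  offset k x = (x + (n ∸ k)) % n

  -- The place of an offset in the zigzag 0, 1, -1, 2, -2, ..., m: a positive `d ≤ m` comes at 2d -
  -- 1 and -e at 2e. Truncated subtraction puts the offset 0 at place 0.
  zag : ℕ → ℕ
  zag d with d ≤? m
  ... | yes _ = d + d ∸ 1
  ... | no  _ = (n ∸ d) + (n ∸ d)

  pos : ℕ → ℕ → ℕ
  pos k x = zag (offset k x)

  zag-low : ∀ {d} → d ≤ m → zag d ≡ d + d ∸ 1
  zag-low {d} d≤m with d ≤? m
  ... | yes _   = refl
  ... | no  d≰m = contradiction d≤m d≰m

  zag-high : ∀ {d} → m < d → zag d ≡ (n ∸ d) + (n ∸ d)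
  zag-high {d} m<d with d ≤? m
  ... | yes d≤m = contradiction d≤m (<⇒≱ m<d)
  ... | no  _   = refl

  zag-high′ : ∀ {d e} → d + e ≡ n → m < d → zag d ≡ e + e
  zag-high′ {d} {e} d+e≡n m<d = trans (zag-high m<d)
    (cong (λ z → z + z) (trans (cong (_∸ d) (sym d+e≡n)) (m+n∸m≡n d e)))

  high : ∀ {d} → m < d → d < n → ∃ λ e → d + e ≡ n × 0 < e × e < m
  high {d} m<d d<n = n ∸ d , d+e≡n , m<n⇒0<n∸m d<n ,
    +-cancelˡ-< m _ _ (subst (m + (n ∸ d) <_) (trans d+e≡n n≡m+m) (+-monoˡ-< (n ∸ d) m<d))
    where d+e≡n = m+[n∸m]≡n (<⇒≤ d<n)

  zag<n : ∀ {d} → d < n → zag d < n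
  zag<n {d} d<n with ≤-<-connex d m
  zag<n {zero}  d<n | inj₁ d≤m = subst (_< n) (sym (zag-low d≤m)) d<n
  zag<n {suc d} d<n | inj₁ d≤m = subst₂ _<_ (sym (zag-low d≤m)) (sym n≡m+m)
    (+-mono-≤ d≤m d≤m)
  ... | inj₂ m<d with high m<d d<n
  ... | e , d+e≡n , _ , e<m = subst₂ _<_ (sym (zag-high′ d+e≡n m<d)) (sym n≡m+m)
    (+-mono-< e<m e<m)

  zag-low≢high : ∀ {d d′} → d ≤ m → m < d′ → d′ < n → zag d ≢ zag d′
  zag-low≢high {d} {d′} d≤m m<d′ d′<n eq with high m<d′ d′<n
  zag-low≢high {zero} d≤m m<d′ d′<n eq | suc e , d′+e≡n , _ =
    0≢1+n (trans (sym (zag-low d≤m)) (trans eq (zag-high′ d′+e≡n m<d′)))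
  zag-low≢high {suc d} d≤m m<d′ d′<n eq | e , d′+e≡n , _ = odd≢even d e
    (trans (sym (+-suc d d)) (trans (sym (zag-low d≤m)) (trans eq (zag-high′ d′+e≡n m<d′))))

  zag-injective : ∀ {d d′} → d < n → d′ < n → zag d ≡ zag d′ → d ≡ d′
  zag-injective {d} {d′} d<n d′<n eq with ≤-<-connex d m | ≤-<-connex d′ m
  ... | inj₁ d≤m | inj₂ m<d′ = contradiction eq (zag-low≢high d≤m m<d′ d′<n)
  ... | inj₂ m<d | inj₁ d′≤m = contradiction (sym eq) (zag-low≢high d′≤m m<d d<n)
  ... | inj₂ m<d | inj₂ m<d′ with high m<d d<n | high m<d′ d′<n
  ... | e , d+e≡n , _ | e′ , d′+e′≡n , _ = +-cancelʳ-≡ e d d′ (begin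
    d + e    ≡⟨ d+e≡n ⟩
    n        ≡⟨ d′+e′≡n ⟨
    d′ + e′  ≡⟨ cong (d′ +_) (+-self-injective (begin
      e + e    ≡⟨ zag-high′ d+e≡n m<d ⟨
      zag d    ≡⟨ eq ⟩
      zag d′   ≡⟨ zag-high′ d′+e′≡n m<d′ ⟩
      e′ + e′  ∎)) ⟨
    d′ + e   ∎)
    where open ≡-Reasoning
  zag-injective {zero} {zero} _ _ eq | inj₁ d≤m | inj₁ d′≤m = refl
  zag-injective {zero} {suc d′} _ _ eq | inj₁ d≤m | inj₁ d′≤m =
    contradiction (trans (sym (zag-low d≤m)) (trans eq (trans (zag-low d′≤m) (+-suc d′ d′)))) 0≢1+n
  zag-injective {suc d} {zero} _ _ eq | inj₁ d≤m | inj₁ d′≤m =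
    contradiction (trans (sym (zag-low d′≤m)) (trans (sym eq) (trans (zag-low d≤m) (+-suc d d)))) 0≢1+n
  zag-injective {suc d} {suc d′} _ _ eq | inj₁ d≤m | inj₁ d′≤m =
    cong suc (+-self-injective (suc-injective (trans (sym (+-suc d d))
      (trans (sym (zag-low d≤m)) (trans eq (trans (zag-low d′≤m) (+-suc d′ d′)))))))

  Consecutive : ℕ → ℕ → Set
  Consecutive i j = (j ≡ suc i) ⊎ (i ≡ suc j)

  Consecutive-sym : ∀ {i j} → Consecutive i j → Consecutive j i
  Consecutive-sym = swap

  -- Offsets with sum 0 modulo `n` are d and -d, at places 2d - 1 and 2d; those with sum 1 are d and
  -- 1 - d, at places 2d - 1 and 2d - 2. Only the pair 0, 1 does not wrap around.
  zag-consecutive-< : ∀ {d d′ e} → d < d′ → d′ < n → e < 2 → (d + d′ ≡ e) ⊎ (d + d′ ≡ n + e) →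
                      Consecutive (zag d) (zag d′)
  zag-consecutive-< {d} {suc d′} {zero} d<d′ d′<n _ (inj₁ eq) =
    contradiction (trans (sym (+-suc d d′)) eq) 1+n≢0
  zag-consecutive-< {zero} {suc d′} {suc zero} d<d′ d′<n _ (inj₁ refl) =
    inj₁ (trans (zag-low {1} (s≤s z≤n)) (cong suc (sym (zag-low {0} z≤n))))
  zag-consecutive-< {suc d} {suc d′} {suc zero} d<d′ d′<n _ (inj₁ eq) =
    contradiction (trans (sym (+-suc d d′)) (suc-injective eq)) 1+n≢0
  zag-consecutive-< {zero} {d′} d<d′ d′<n _ (inj₂ refl) = contradiction d′<n (≤⇒≯ (m≤m+n n _))
  zag-consecutive-< {suc d} {d′} {zero} d<d′ d′<n _ (inj₂ eq) = inj₁ (begin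
    zag d′              ≡⟨ zag-high′ (trans (+-comm d′ (suc d)) eq₀) m<d′ ⟩
    suc (d + suc d)     ≡⟨ cong suc (zag-low (<⇒≤ d<m)) ⟨
    suc (zag (suc d))   ∎)
    where
    open ≡-Reasoning
    eq₀ = trans eq (+-identityʳ n)
    d<m : suc d < m
    d<m = ≰⇒> λ m≤d → <⇒≱ (+-mono-≤-< m≤d (≤-<-trans m≤d d<d′)) (≤-reflexive (trans eq₀ n≡m+m))
    m<d′ : m < d′
    m<d′ = ≰⇒> λ d′≤m → <⇒≱ (+-mono-<-≤ (<-≤-trans d<d′ d′≤m) d′≤m) (≤-reflexive (trans (sym n≡m+m) (sym eq₀)))
  zag-consecutive-< {suc d} {d′} {suc zero} d<d′ d′<n _ (inj₂ eq) = inj₂ (begin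
    zag (suc d)     ≡⟨ zag-low d≤m ⟩
    d + suc d       ≡⟨ +-suc d d ⟩
    suc (d + d)     ≡⟨ cong suc (zag-high′ (trans (+-comm d′ d) eq₀) m<d′) ⟨
    suc (zag d′)    ∎)
    where
    open ≡-Reasoning
    eq₀ : d + d′ ≡ n
    eq₀ = suc-injective (trans eq (+-comm n 1))
    d≤m : suc d ≤ m
    d≤m = ≮⇒≥ λ m≤d → <⇒≱ (+-mono-≤-< (≤-pred m≤d) (≤-<-trans (≤-trans (≤-pred m≤d) (n≤1+n d)) d<d′))
      (≤-reflexive (trans eq₀ n≡m+m))
    m<d′ : m < d′
    m<d′ = ≰⇒> λ d′≤m → <⇒≱ (+-mono-<-≤ (≤-trans (<⇒≤ d<d′) d′≤m) d′≤m)
      (≤-reflexive (trans (sym n≡m+m) (sym eq₀)))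
  zag-consecutive-< {e = suc (suc _)} _ _ (s≤s (s≤s ())) _

  zag-consecutive : ∀ {d d′ e} → d < n → d′ < n → d ≢ d′ → e < 2 →
                    (d + d′ ≡ e) ⊎ (d + d′ ≡ n + e) → Consecutive (zag d) (zag d′)
  zag-consecutive {d} {d′} {e} d<n d′<n d≢d′ e<2 sum with <-cmp d d′
  ... | tri< d<d′ _ _ = zag-consecutive-< d<d′ d′<n e<2 sum
  ... | tri≈ _ d≡d′ _ = contradiction d≡d′ d≢d′
  ... | tri> _ _ d′<d = Consecutive-sym (zag-consecutive-< d′<d d<n e<2
    (subst (λ z → (z ≡ e) ⊎ (z ≡ n + e)) (+-comm d d′) sum))

  offset<n : ∀ k x → offset k x < n
  offset<n k x = m%n<n (x + (n ∸ k)) n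

  pos<n : ∀ k x → pos k x < n
  pos<n k x = zag<n (offset<n k x)

  pos-injective : ∀ k {x y} → x < n → y < n → pos k x ≡ pos k y → x ≡ y
  pos-injective k {x} {y} x<n y<n eq = %-+-cancelʳ (n ∸ k) x<n y<n
    (zag-injective (offset<n k x) (offset<n k y) eq)

  %-split : ∀ {a} → a < n + n → (a ≡ a % n) ⊎ (a ≡ n + a % n)
  %-split {a} a<2n with <-≤-connex a n
  ... | inj₁ a<n = inj₁ (sym (m<n⇒m%n≡m a<n))
  ... | inj₂ n≤a = inj₂ (begin
    a              ≡⟨ m+[n∸m]≡n n≤a ⟨
    n + (a ∸ n)    ≡⟨ cong (n +_) (m<n⇒m%n≡m (m<n+o⇒m∸n<o a n a<2n)) ⟨
    n + (a ∸ n) % n ≡⟨ cong (n +_) (m≤n⇒[n∸m]%m≡n%m n≤a) ⟩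
    n + a % n      ∎)
    where open ≡-Reasoning

  -- The residue of `x + y` is 2k + e with `e` equal to 0 or 1; measuring both labels from `k`
  -- removes the 2k.
  offset-sum : ∀ {x y} → let k = cycle x y in
               (offset k x + offset k y) % n ≡ (x + y) % n % 2
  offset-sum {x} {y} = begin
    (offset k x + offset k y) % n  ≡⟨ %-distribˡ-+ (x + (n ∸ k)) (y + (n ∸ k)) n ⟨
    (x + (n ∸ k) + (y + (n ∸ k))) % n  ≡⟨ cong (_% n) (interchange x y (n ∸ k)) ⟩
    (x + y + (n ∸ k) * 2) % n      ≡⟨ %-distribˡ-+ (x + y) ((n ∸ k) * 2) n ⟩
    (σ + (n ∸ k) * 2 % n) % n      ≡⟨ cong (λ z → (z + (n ∸ k) * 2 % n) % n) (m%n%n≡m%n (x + y) n) ⟨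
    (σ % n + (n ∸ k) * 2 % n) % n  ≡⟨ %-distribˡ-+ σ ((n ∸ k) * 2) n ⟨
    (σ + (n ∸ k) * 2) % n          ≡⟨ cong (λ z → (z + (n ∸ k) * 2) % n) (m≡m%n+[m/n]*n σ 2) ⟩
    (e + k * 2 + (n ∸ k) * 2) % n  ≡⟨ cong (_% n) (factor e k (n ∸ k)) ⟩
    (e + 2 * (k + (n ∸ k))) % n    ≡⟨ cong (λ z → (e + 2 * z) % n) (m+[n∸m]≡n k≤n) ⟩
    (e + 2 * n) % n                ≡⟨ [m+kn]%n≡m%n e 2 n ⟩
    e % n                          ≡⟨ m<n⇒m%n≡m (<-≤-trans (m%n<n σ 2) (s≤s (s≤s z≤n))) ⟩
    e                              ∎
    where
    open ≡-Reasoning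
    k = cycle x y
    σ = (x + y) % n
    e = σ % 2
    k≤n = <⇒≤ (<-trans (cycle<m x y) m<n)
    interchange : ∀ x y z → x + z + (y + z) ≡ x + y + z * 2
    interchange = solve-∀
    factor : ∀ e k l → e + k * 2 + l * 2 ≡ e + 2 * (k + l)
    factor = solve-∀

  cycle-consecutive : ∀ {x y} → x < n → y < n → x ≢ y →
                      Consecutive (pos (cycle x y) x) (pos (cycle x y) y)
  cycle-consecutive {x} {y} x<n y<n x≢y = zag-consecutive (offset<n k x) (offset<n k y)
    (λ eq → x≢y (%-+-cancelʳ (n ∸ k) x<n y<n eq)) (m%n<n ((x + y) % n) 2)
    (subst (λ e → (d ≡ e) ⊎ (d ≡ n + e)) (offset-sum {x} {y})
      (%-split (+-mono-< (offset<n k x) (offset<n k y))))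
    where
    k = cycle x y
    d = offset k x + offset k y

  -- The vertices with `x % m` equal to k are k and k + m, the first and the last finite vertex of
  -- cycle k, which are its neighbours of ∞.
  pos-end : ∀ {x} → x < n → (pos (x % m) x ≡ 0) ⊎ (suc (pos (x % m) x) ≡ n)
  pos-end {x} x<n with <-≤-connex x m
  ... | inj₁ x<m = inj₁ (trans (cong zag off) (zag-low {0} z≤n))
    where
    open ≡-Reasoning
    off : offset (x % m) x ≡ 0
    off = begin
      (x + (n ∸ x % m)) % n  ≡⟨ cong (λ z → (x + (n ∸ z)) % n) (m<n⇒m%n≡m x<m) ⟩
      (x + (n ∸ x)) % n      ≡⟨ cong (_% n) (m+[n∸m]≡n (<⇒≤ x<n)) ⟩
      n % n                  ≡⟨ n%n≡0 n ⟩
      0                      ∎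
  ... | inj₂ m≤x = inj₂ (trans (cong suc (trans (cong zag off) (zag-low {m} ≤-refl))) (sym n≡m+m))
    where
    open ≡-Reasoning
    y = x ∸ m
    y<m : y < m
    y<m = m<n+o⇒m∸n<o x m (subst (x <_) n≡m+m x<n)
    x≡m+y = sym (m+[n∸m]≡n m≤x)
    x%m≡y : x % m ≡ y
    x%m≡y = trans (sym (m≤n⇒[n∸m]%m≡n%m m≤x)) (m<n⇒m%n≡m y<m)
    off : offset (x % m) x ≡ m
    off = begin
      (x + (n ∸ x % m)) % n  ≡⟨ cong₂ (λ z w → (z + (n ∸ w)) % n) x≡m+y x%m≡y ⟩
      (m + y + (n ∸ y)) % n  ≡⟨ cong (_% n) (+-assoc m y (n ∸ y)) ⟩
      (m + (y + (n ∸ y))) % n ≡⟨ cong (λ z → (m + z) % n) (m+[n∸m]≡n (<⇒≤ (<-trans y<m m<n))) ⟩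
      (m + n) % n            ≡⟨ [m+n]%n≡m%n m n ⟩
      m % n                  ≡⟨ m<n⇒m%n≡m m<n ⟩
      m                      ∎

  -- `zero` is the point ∞ and `suc x` is the residue `x`.
  Label : Set
  Label = Fin (suc n)

  slot : Fin m → Fin n → ℕ
  slot k x = pos (toℕ k) (toℕ x)

  slot<n : ∀ k x → slot k x < n
  slot<n k x = pos<n (toℕ k) (toℕ x)

  slot-injective : ∀ k {x y} → slot k x ≡ slot k y → x ≡ y
  slot-injective k {x} {y} eq = Fin.toℕ-injective (pos-injective (toℕ k) (Fin.toℕ<n x) (Fin.toℕ<n y) eq)

  index : Label → Label → Fin m
  -- An arbitrary value: there is no loop at ∞.
  index zero    zero    = zero
  index zero    (suc y) = toℕ y mod m
  index (suc x) zero    = toℕ x mod m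
  index (suc x) (suc y) = Fin.fromℕ< (cycle<m (toℕ x) (toℕ y))

  index-sym : ∀ x y → index x y ≡ index y x
  index-sym zero    zero    = refl
  index-sym zero    (suc y) = refl
  index-sym (suc x) zero    = refl
  index-sym (suc x) (suc y) = Fin.fromℕ<-cong _ _
    (cong (λ z → z % n / 2) (+-comm (toℕ x) (toℕ y))) _ _

  -- ∞ is joined only to the two ends of the finite path, so a position other than 0 is taken to be
  -- the last one, whose edge closes the cycle with number `n`.
  spoke : ℕ → ℕ
  spoke zero    = 0
  spoke (suc _) = n

  -- Edges are numbered along the cycle, starting from ∞.
  rank : Fin m → Label → Label → ℕ
  rank k zero    zero    = 0
  rank k zero    (suc y) = spoke (slot k y)
  rank k (suc x) zero    = spoke (slot k x)
  rank k (suc x) (suc y) = suc (slot k x ⊓ slot k y)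

  rank-sym : ∀ k x y → rank k x y ≡ rank k y x
  rank-sym k zero    zero    = refl
  rank-sym k zero    (suc y) = refl
  rank-sym k (suc x) zero    = refl
  rank-sym k (suc x) (suc y) = cong suc (⊓-comm (slot k x) (slot k y))

  rim : ∀ {k x y} → index (suc x) (suc y) ≡ k → x ≢ y → Consecutive (slot k x) (slot k y)
  rim {x = x} {y} refl x≢y = subst (λ k → Consecutive (pos k (toℕ x)) (pos k (toℕ y)))
    (sym (Fin.toℕ-fromℕ< (cycle<m (toℕ x) (toℕ y))))
    (cycle-consecutive (Fin.toℕ<n x) (Fin.toℕ<n y) (x≢y ∘ Fin.toℕ-injective))

  spoke-end : ∀ {k x} → toℕ x mod m ≡ k → (slot k x ≡ 0) ⊎ (suc (slot k x) ≡ n)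
  spoke-end {x = x} refl = subst (λ k → (pos k (toℕ x) ≡ 0) ⊎ (suc (pos k (toℕ x)) ≡ n))
    (sym (Fin.toℕ-fromℕ< (m%n<n (toℕ x) m))) (pos-end (Fin.toℕ<n x))

  ⊓-Consecutive : ∀ {p q} → Consecutive p q → (p ⊓ q ≡ p × q ≡ suc p) ⊎ (p ⊓ q ≡ q × p ≡ suc q)
  ⊓-Consecutive {p} {q} (inj₁ eq) = inj₁ (m≤n⇒m⊓n≡m (subst (p ≤_) (sym eq) (n≤1+n p)) , eq)
  ⊓-Consecutive {p} {q} (inj₂ eq) = inj₂ (m≥n⇒m⊓n≡n (subst (q ≤_) (sym eq) (n≤1+n q)) , eq)

  ⊓-determines : ∀ {p q p′ q′} → Consecutive p q → Consecutive p′ q′ → p ⊓ q ≡ p′ ⊓ q′ →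
                 (p ≡ p′ × q ≡ q′) ⊎ (p ≡ q′ × q ≡ p′)
  ⊓-determines c c′ eq with ⊓-Consecutive c | ⊓-Consecutive c′
  ... | inj₁ (a , refl) | inj₁ (a′ , refl) = inj₁ (e , cong suc e) where e = trans (sym a) (trans eq a′)
  ... | inj₁ (a , refl) | inj₂ (a′ , refl) = inj₂ (e , cong suc e) where e = trans (sym a) (trans eq a′)
  ... | inj₂ (a , refl) | inj₁ (a′ , refl) = inj₂ (cong suc e , e) where e = trans (sym a) (trans eq a′)
  ... | inj₂ (a , refl) | inj₂ (a′ , refl) = inj₁ (cong suc e , e) where e = trans (sym a) (trans eq a′)

  -- Neighbours in the cyclic order of the edge numbers 0, ..., n. The orientation of the closing
  -- pair is immaterial, since its two edges always receive different shades.
  Follows : ℕ → ℕ → Set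
  Follows i j = j ≡ suc i ⊎ (i ≡ 0 × j ≡ n)

  spoke-pos : ∀ {p} → suc p ≡ n → spoke p ≡ n
  spoke-pos {suc _} _ = refl

  rim-spoke : ∀ {p q} → (p ≡ 0) ⊎ (suc p ≡ n) → q < n → Consecutive p q →
              Follows (spoke p) (suc (p ⊓ q)) ⊎ Follows (suc (p ⊓ q)) (spoke p)
  rim-spoke {p} {q} (inj₁ refl) q<n c = inj₁ (inj₁ refl)
  rim-spoke {p} {q} (inj₂ p-last) q<n (inj₁ refl) = contradiction q<n (<⇒≱ (subst (_< suc q) p-last ≤-refl))
  rim-spoke {p} {q} (inj₂ p-last) q<n (inj₂ refl) = inj₂ (inj₁ (trans (sym p-last)
    (cong suc (cong suc (sym (m≥n⇒m⊓n≡n (n≤1+n q)))))))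

  rim-rim : ∀ {p q r} → Consecutive p q → Consecutive p r → q ≢ r →
            Follows (suc (p ⊓ q)) (suc (p ⊓ r)) ⊎ Follows (suc (p ⊓ r)) (suc (p ⊓ q))
  rim-rim c c′ q≢r with ⊓-Consecutive c | ⊓-Consecutive c′
  ... | inj₁ (a , refl) | inj₁ (a′ , refl) = contradiction refl q≢r
  ... | inj₁ (a , refl) | inj₂ (a′ , refl) = inj₂ (inj₁ (cong suc (trans a (cong suc (sym a′)))))
  ... | inj₂ (a , refl) | inj₁ (a′ , refl) = inj₁ (inj₁ (cong suc (trans a′ (cong suc (sym a)))))
  ... | inj₂ (a , e) | inj₂ (a′ , e′) = contradiction (suc-injective (trans (sym e) e′)) q≢r

  rank-follows : ∀ {k} x y z → x ≢ y → x ≢ z → y ≢ z → index x y ≡ k → index x z ≡ k →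
                 Follows (rank k x y) (rank k x z) ⊎ Follows (rank k x z) (rank k x y)
  rank-follows zero zero _ x≢y _ _ _ _ = contradiction refl x≢y
  rank-follows zero (suc _) zero _ x≢z _ _ _ = contradiction refl x≢z
  rank-follows {k} zero (suc y) (suc z) _ _ y≢z ky kz with spoke-end {x = y} ky | spoke-end {x = z} kz
  ... | inj₁ a | inj₁ b = contradiction (cong suc (slot-injective k (trans a (sym b)))) y≢z
  ... | inj₁ a | inj₂ b = inj₁ (inj₂ (cong spoke a , spoke-pos b))
  ... | inj₂ a | inj₁ b = inj₂ (inj₂ (cong spoke b , spoke-pos a))
  ... | inj₂ a | inj₂ b = contradiction (cong suc (slot-injective k (suc-injective (trans a (sym b))))) y≢z
  rank-follows (suc _) zero zero _ _ y≢z _ _ = contradiction refl y≢z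
  rank-follows {k} (suc x) zero (suc z) _ x≢z _ ky kz =
    rim-spoke (spoke-end {x = x} ky) (slot<n k z) (rim kz (x≢z ∘ cong suc))
  rank-follows {k} (suc x) (suc y) zero x≢y _ _ ky kz =
    swap (rim-spoke (spoke-end {x = x} kz) (slot<n k y) (rim ky (x≢y ∘ cong suc)))
  rank-follows {k} (suc x) (suc y) (suc z) x≢y x≢z y≢z ky kz =
    rim-rim (rim ky (x≢y ∘ cong suc)) (rim kz (x≢z ∘ cong suc)) (y≢z ∘ cong suc ∘ slot-injective k)

  parity : ℕ → Fin 2
  parity zero          = zero
  parity (suc zero)    = suc zero
  parity (suc (suc a)) = parity a

  parity-suc : ∀ a → parity (suc a) ≢ parity a
  parity-suc (suc zero)    ()
  parity-suc (suc (suc a)) eq = parity-suc a eq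

  parity-*2 : ∀ a → parity (a * 2) ≡ zero
  parity-*2 zero    = refl
  parity-*2 (suc a) = parity-*2 a

  -- The edges of a cycle alternate between two colours, except that the
  -- pattern is flipped from the edge numbered r on.
  shade : ℕ → ℕ → Fin 2
  shade r i with i <? r
  ... | yes _ = parity i
  ... | no  _ = parity (suc i)

  shade-< : ∀ {r i} → i < r → shade r i ≡ parity i
  shade-< {r} {i} i<r with i <? r
  ... | yes _  = refl
  ... | no i≮r = contradiction i<r i≮r

  shade-≥ : ∀ {r i} → r ≤ i → shade r i ≡ parity (suc i)
  shade-≥ {r} {i} r≤i with i <? r
  ... | yes i<r = contradiction i<r (≤⇒≯ r≤i)
  ... | no  _   = refl

  -- The cycle has odd length `n + 1`, so alternation alone would give the adjacent edges 0 and `n`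
  -- the same colour. Flipping from `r` on moves this unavoidable repetition to the edges `r − 1`
  -- and `r`.
  shade-follows : ∀ {r i j} → 0 < r → r ≤ n → Follows i j → shade r i ≡ shade r j → j ≡ r
  shade-follows {r} {i} 0<r r≤n (inj₁ refl) eq with <-≤-connex i r | <-≤-connex (suc i) r
  ... | inj₁ i<r | inj₂ r≤j = ≤-antisym i<r r≤j
  ... | inj₁ i<r | inj₁ j<r =
    contradiction (trans (sym (shade-< j<r)) (trans (sym eq) (shade-< i<r))) (parity-suc i)
  ... | inj₂ r≤i | inj₁ j<r = contradiction (<-≤-trans j<r r≤i) (<-asym ≤-refl)
  ... | inj₂ r≤i | inj₂ r≤j =
    contradiction (trans (sym (shade-≥ r≤j)) (trans (sym eq) (shade-≥ r≤i))) (parity-suc (suc i))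
  shade-follows {r} 0<r r≤n (inj₂ (refl , refl)) eq =
    contradiction (trans (sym (shade-≥ r≤n)) (trans (sym eq) (shade-< 0<r)))
      (λ e → parity-suc n (trans e (sym (parity-*2 m))))

  -- The colouring is proper except at one edge {b k , b′ k} of every cycle k.
  module Coloured (b b′ : Fin m → Fin n) (b≢b′ : ∀ k → b k ≢ b′ k)
                  (b∈k : ∀ k → index (suc (b k)) (suc (b′ k)) ≡ k) where

    gap : Fin m → ℕ
    gap k = rank k (suc (b k)) (suc (b′ k))

    gap<n : ∀ k → gap k < n
    gap<n k with ⊓-Consecutive (rim (b∈k k) (b≢b′ k))
    ... | inj₁ (e , e′) = subst (_< n) (trans e′ (cong suc (sym e))) (slot<n k (b′ k))
    ... | inj₂ (e , e′) = subst (_< n) (trans e′ (cong suc (sym e))) (slot<n k (b k))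

    colour : Label → Label → Fin n
    colour x y = Fin.combine k (shade (gap k) (rank k x y)) where k = index x y

    colour-sym : ∀ x y → colour x y ≡ colour y x
    colour-sym x y rewrite index-sym y x | rank-sym (index x y) x y = refl

    Gap : Label → Label → Set
    Gap x y = ∃ λ k → (x ≡ suc (b k) × y ≡ suc (b′ k)) ⊎ (x ≡ suc (b′ k) × y ≡ suc (b k))

    spoke≢gap : ∀ k p → spoke p ≢ gap k
    spoke≢gap k (suc p) eq = <⇒≢ (gap<n k) (sym eq)

    rank≡gap : ∀ x y {k} → x ≢ y → index x y ≡ k → rank k x y ≡ gap k → Gap x y
    rank≡gap zero    zero    {k} x≢y _ _ = contradiction refl x≢y
    rank≡gap zero    (suc y) {k} x≢y ky eq = contradiction eq (spoke≢gap k (slot k y))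
    rank≡gap (suc x) zero    {k} x≢y ky eq = contradiction eq (spoke≢gap k (slot k x))
    rank≡gap (suc x) (suc y) {k} x≢y ky eq
      with ⊓-determines (rim ky (x≢y ∘ cong suc)) (rim (b∈k k) (b≢b′ k)) (suc-injective eq)
    ... | inj₁ (e , e′) = k , inj₁ (cong suc (slot-injective k e) , cong suc (slot-injective k e′))
    ... | inj₂ (e , e′) = k , inj₂ (cong suc (slot-injective k e) , cong suc (slot-injective k e′))

    colour-proper : ∀ {x y z} → x ≢ y → x ≢ z → y ≢ z → colour x y ≡ colour x z → Gap x y ⊎ Gap x z
    colour-proper {x} {y} {z} x≢y x≢z y≢z eq with Fin.combine-injective _ _ _ _ eq
    ... | k-eq , shade-eq = conclude (index x y) refl (sym k-eq) (trans shade-eq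
      (cong (λ k → shade (gap k) (rank k x z)) (sym k-eq)))
      where
      conclude : ∀ k → index x y ≡ k → index x z ≡ k →
                 shade (gap k) (rank k x y) ≡ shade (gap k) (rank k x z) → Gap x y ⊎ Gap x z
      conclude k ky kz e with rank-follows x y z x≢y x≢z y≢z ky kz
      ... | inj₁ f = inj₂ (rank≡gap x z x≢z kz (shade-follows (s≤s z≤n) (<⇒≤ (gap<n k)) f e))
      ... | inj₂ f = inj₁ (rank≡gap x y x≢y ky (shade-follows (s≤s z≤n) (<⇒≤ (gap<n k)) f (sym e)))

-- The elements 0, …, u, 2u, 2u + (u+1), 2u + 2(u+1), …: sums of two distinct
-- ones among the first u + 1 + b fill an interval.
element : ℕ → ℕ → ℕ
element u i with i ≤? u
... | yes _ = i
... | no  _ = u + u + (i ∸ suc u) * suc u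

element-low : ∀ {u i} → i ≤ u → element u i ≡ i
element-low {u} {i} i≤u with i ≤? u
... | yes _  = refl
... | no i≰u = contradiction i≤u i≰u

element-high : ∀ u j → element u (suc u + j) ≡ u + u + j * suc u
element-high u j with suc u + j ≤? u
... | yes u+j≤u = contradiction u+j≤u (<⇒≱ (s≤s (m≤m+n u j)))
... | no  _     = cong (λ z → u + u + z * suc u) (m+n∸m≡n (suc u) j)

data ElementView (u : ℕ) : ℕ → Set where
  low  : ∀ {i} → i ≤ u → ElementView u i
  high : ∀ j → ElementView u (suc u + j)

elementView : ∀ u i → ElementView u i
elementView u i with ≤-<-connex i u
... | inj₁ i≤u = low i≤u
... | inj₂ u<i = subst (ElementView u) (m+[n∸m]≡n u<i) (high (i ∸ suc u))

element-mono-< : ∀ {u i j} → 1 ≤ u → i < j → element u i < element u j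
element-mono-< {u} {i} {j} 1≤u i<j with elementView u i | elementView u j
... | low i≤u | low j≤u = subst₂ _<_ (sym (element-low i≤u)) (sym (element-low j≤u)) i<j
... | low i≤u | high j′ = subst₂ _<_ (sym (element-low i≤u)) (sym (element-high u j′))
  (≤-<-trans i≤u (<-≤-trans (m<m+n u 1≤u) (m≤m+n (u + u) (j′ * suc u))))
... | high i′ | low j≤u = contradiction (<-≤-trans i<j j≤u) (≤⇒≯ (≤-trans (n≤1+n u) (m≤m+n (suc u) i′)))
... | high i′ | high j′ = subst₂ _<_ (sym (element-high u i′)) (sym (element-high u j′))
  (+-monoʳ-< (u + u) (*-monoˡ-< (suc u) (+-cancelˡ-< (suc u) i′ j′ i<j)))

element-injective : ∀ {u i j} → 1 ≤ u → element u i ≡ element u j → i ≡ j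
element-injective {u} {i} {j} 1≤u eq with <-cmp i j
... | tri< i<j _ _ = contradiction eq (<⇒≢ (element-mono-< 1≤u i<j))
... | tri≈ _ i≡j _ = i≡j
... | tri> _ _ j<i = contradiction (sym eq) (<⇒≢ (element-mono-< 1≤u j<i))

element-< : ∀ {u b i M} → u < M → (∀ j → j < b → u + u + j * suc u < M) →
            i < suc u + b → element u i < M
element-< {u} {b} {i} u<M bound i< with elementView u i
... | low i≤u = subst (_< _) (sym (element-low i≤u)) (≤-<-trans i≤u u<M)
... | high j  = subst (_< _) (sym (element-high u j)) (bound j (+-cancelˡ-< (suc u) j b i<))

-- The low elements alone give 1, ..., 2u - 1. From 2u on, the high elements are spaced by `u + 1`,
-- and adding 0, ..., u to one of them fills the space up to the next: the quotient chooses the high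
-- element and the remainder the low one.
element-sums : ∀ {u b τ} → 1 ≤ τ → τ < u + u + b * suc u →
               ∃₂ λ i j → i ≢ j × i < suc u + b × j < suc u + b × element u i + element u j ≡ τ
element-sums {u} {b} {τ} 1≤τ τ< with ≤-<-connex τ u
... | inj₁ τ≤u = 0 , τ , <⇒≢ 1≤τ , s≤s z≤n , s≤s (≤-trans τ≤u (m≤m+n u b)) ,
  cong₂ _+_ (element-low {u} z≤n) (element-low τ≤u)
... | inj₂ u<τ with <-≤-connex τ (u + u)
... | inj₁ τ<2u = τ ∸ u , u , <⇒≢ τ∸u<u , s≤s (≤-trans (<⇒≤ τ∸u<u) (m≤m+n u b)) , s≤s (m≤m+n u b) ,
  trans (cong₂ _+_ (element-low (<⇒≤ τ∸u<u)) (element-low {u} ≤-refl)) (m∸n+n≡m (<⇒≤ u<τ))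
  where τ∸u<u = +-cancelˡ-< u _ _ (subst (_< u + u) (sym (m+[n∸m]≡n (<⇒≤ u<τ))) τ<2u)
... | inj₂ 2u≤τ = i , suc u + j , <⇒≢ (<-≤-trans i≤u (m≤m+n (suc u) j)) ,
  <-≤-trans i≤u (m≤m+n (suc u) b) , +-monoʳ-< (suc u) j<b , (begin
    element u i + element u (suc u + j)  ≡⟨ cong₂ _+_ (element-low (≤-pred i≤u)) (element-high u j) ⟩
    i + (u + u + j * suc u)  ≡⟨ rearrange i (u + u) (j * suc u) ⟩
    u + u + (i + j * suc u)  ≡⟨ cong (u + u +_) (m≡m%n+[m/n]*n δ (suc u)) ⟨
    u + u + δ                ≡⟨ m+[n∸m]≡n 2u≤τ ⟩
    τ                        ∎)
  where
  open ≡-Reasoning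
  δ = τ ∸ (u + u)
  i = δ % suc u
  j = δ / suc u
  i≤u : i < suc u
  i≤u = m%n<n δ (suc u)
  j<b : j < b
  j<b = m<n*o⇒m/o<n (+-cancelˡ-< (u + u) δ (b * suc u) (subst (_< u + u + b * suc u) (sym (m+[n∸m]≡n 2u≤τ)) τ<))
  rearrange : ∀ x y z → x + (y + z) ≡ y + (x + z)
  rearrange = solve-∀

-- Extending partial injections

InjectiveBelow : ∀ {A : Set} → ℕ → (ℕ → A) → Set
InjectiveBelow k f = ∀ {i j} → i < k → j < k → f i ≡ f j → i ≡ j

-- If every value were hit, a choice of preimages would inject `Fin n` into the smaller `Fin k`.
injectiveBelow-misses : ∀ {k n} (f : ℕ → Fin n) → k < n → ∃ λ y → ∀ i → i < k → f i ≢ y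
injectiveBelow-misses {k} {n} f k<n
  with Fin.all? (λ y → Fin.any? (λ (i : Fin k) → f (toℕ i) Fin.≟ y))
... | yes hit = contradiction (λ {y} {z} eq → trans (sym (proj₂ (hit y)))
  (trans (cong (f ∘ toℕ) eq) (proj₂ (hit z)))) (Fin.<⇒notInjective {f = proj₁ ∘ hit} k<n)
... | no ¬hit with Fin.¬∀⟶∃¬ n _ (λ y → Fin.any? (λ (i : Fin k) → f (toℕ i) Fin.≟ y)) ¬hit
... | y , missed = y , λ i i<k eq → missed (fromℕ< i<k , trans (cong f (Fin.toℕ-fromℕ< i<k)) eq)

override : ∀ {A : Set} → ℕ → A → (ℕ → A) → ℕ → A
override k y f i with i ≟ k
... | yes _ = y
... | no  _ = f i

-- Covering the cycles prescribes only some labels; the remaining vertices may take any free ones,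
-- chosen greedily. `r` counts the arguments still open.
extend-injection : ∀ {n} r k (f : ℕ → Fin n) → r + k ≡ n → InjectiveBelow k f →
                   ∃ λ (g : ℕ → Fin n) → InjectiveBelow n g × (∀ i → i < k → g i ≡ f i)
extend-injection zero    k f refl inj = f , inj , λ _ _ → refl
extend-injection {n} (suc r) k f eq inj
  with injectiveBelow-misses {k} f (subst (k <_) eq (s≤s (m≤n+m k r)))
... | y , missed with extend-injection r (suc k) f′ (trans (+-suc r k) eq) inj′
  where
  f′ = override k y f
  inj′ : InjectiveBelow (suc k) f′
  inj′ {i} {j} i<1+k j<1+k e with i ≟ k | j ≟ k
  ... | yes p | yes q = trans p (sym q)
  ... | yes p | no  q = contradiction (sym e) (missed j (≤∧≢⇒< (≤-pred j<1+k) q))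
  ... | no  p | yes q = contradiction e (missed i (≤∧≢⇒< (≤-pred i<1+k) p))
  ... | no  p | no  q = inj (≤∧≢⇒< (≤-pred i<1+k) p) (≤∧≢⇒< (≤-pred j<1+k) q) e
... | g , g-inj , agrees = g , g-inj , λ i i<k → trans (agrees i (m<n⇒m<1+n i<k)) (agrees′ i i<k)
  where
  agrees′ : ∀ i → i < k → override k y f i ≡ f i
  agrees′ i i<k with i ≟ k
  ... | yes i≡k = contradiction i≡k (<⇒≢ i<k)
  ... | no  _   = refl

-- Placing the vertices

Vertex : ℕ → ℕ → ℕ → Set
Vertex s t p = (Fin s ⊎ Fin t) ⊎ Fin p

pattern left i  = inj₁ (inj₁ i)
pattern right j = inj₁ (inj₂ j)
pattern centre l = inj₂ l

-- `left`, `right` and `centre` will stand for the ideals I₁ × R₂, the ideals R₁ × I₂ and the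
-- non-zero ideals with both factors proper. A clash is a non-edge; outer vertices also clash with
-- themselves, so distinctness is required separately.
Clash : ∀ {s t p} → Vertex s t p → Vertex s t p → Set
Clash (left _)  (left _)  = Unit.⊤
Clash (right _) (right _) = Unit.⊤
Clash _         _         = ⊥

position : ∀ {s t p} → Vertex s t p → ℕ
position         (left i)   = toℕ i
position {s}     (right j)  = s + toℕ j
position {s} {t} (centre l) = s + t + toℕ l

position-injective : ∀ {s t p} {x y : Vertex s t p} → position x ≡ position y → x ≡ y
position-injective {x = left i} {left j} eq = cong (inj₁ ∘ inj₁) (Fin.toℕ-injective eq)
position-injective {s} {x = left i} {right j} eq =
  contradiction eq (<⇒≢ (<-≤-trans (Fin.toℕ<n i) (m≤m+n s _)))
position-injective {s} {t} {x = left i} {centre l} eq =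
  contradiction eq (<⇒≢ (<-≤-trans (Fin.toℕ<n i) (≤-trans (m≤m+n s t) (m≤m+n (s + t) _))))
position-injective {s} {x = right i} {left j} eq =
  contradiction (sym eq) (<⇒≢ (<-≤-trans (Fin.toℕ<n j) (m≤m+n s _)))
position-injective {s} {x = right i} {right j} eq =
  cong (inj₁ ∘ inj₂) (Fin.toℕ-injective (+-cancelˡ-≡ s _ _ eq))
position-injective {s} {t} {x = right i} {centre l} eq =
  contradiction eq (<⇒≢ (<-≤-trans (+-monoʳ-< s (Fin.toℕ<n i)) (m≤m+n (s + t) _)))
position-injective {s} {t} {x = centre l} {left i} eq =
  contradiction (sym eq) (<⇒≢ (<-≤-trans (Fin.toℕ<n i) (≤-trans (m≤m+n s t) (m≤m+n (s + t) _))))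
position-injective {s} {t} {x = centre l} {right i} eq =
  contradiction (sym eq) (<⇒≢ (<-≤-trans (+-monoʳ-< s (Fin.toℕ<n i)) (m≤m+n (s + t) _)))
position-injective {s} {t} {x = centre k} {centre l} eq =
  cong inj₂ (Fin.toℕ-injective (+-cancelˡ-≡ (s + t) _ _ eq))

position-< : ∀ {s t p} (x : Vertex s t p) → position x < s + t + p
position-< {s} {t} {p} (left i)   = <-≤-trans (Fin.toℕ<n i) (≤-trans (m≤m+n s t) (m≤m+n (s + t) p))
position-< {s} {t} {p} (right j)  = <-≤-trans (+-monoʳ-< s (Fin.toℕ<n j)) (m≤m+n (s + t) p)
position-< {s} {t} {p} (centre l) = +-monoʳ-< (s + t) (Fin.toℕ<n l)

least : ∀ (D : ℕ) (g : ℕ → ℕ) → (∀ {i j} → i ≤ j → g i ≤ g j) → ∀ B → D < g B →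
        ∃ λ b → b ≤ B × D < g b × (∀ j → j < b → g j ≤ D)
least D g mono zero    D<gB = 0 , z≤n , D<gB , λ _ ()
least D g mono (suc B) D<gB with <-≤-connex D (g B)
... | inj₂ gB≤D = suc B , ≤-refl , D<gB , λ j j≤B → ≤-trans (mono (≤-pred j≤B)) gB≤D
... | inj₁ D<gB′ with least D g mono B D<gB′
... | b , b≤B , D<gb , below = b , m≤n⇒m≤1+n b≤B , D<gb , below

swapVertex : ∀ {s t p} → Vertex s t p → Vertex t s p
swapVertex = Sum⊎.map₁ swap

swapVertex-injective : ∀ {s t p} {x y : Vertex s t p} → swapVertex x ≡ swapVertex y → x ≡ y
swapVertex-injective {x = left _}   {left _}   refl = refl
swapVertex-injective {x = right _}  {right _}  refl = refl
swapVertex-injective {x = centre _} {centre _} refl = refl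

swapVertex-Clash : ∀ {s t p} (x y : Vertex s t p) → Clash x y → Clash (swapVertex x) (swapVertex y)
swapVertex-Clash (left _)  (left _)  _ = Unit.tt
swapVertex-Clash (right _) (right _) _ = Unit.tt

-- A placement of the vertices on ℤ/2m ∪ {∞} for which every Hamilton cycle of
-- Walecki's decomposition contains a pair of clashing vertices.
record Placement (s t p m′ : ℕ) : Set where
  open Walecki m′
  field
    label     : Vertex s t p → Label
    injective : ∀ {x y} → label x ≡ label y → x ≡ y
    hits      : ∀ k → ∃₂ λ x y → x ≢ y × Clash x y ×
                ∃₂ λ a b → label x ≡ suc a × label y ≡ suc b × index (suc a) (suc b) ≡ k

swapPlacement : ∀ {s t p m′} → Placement s t p m′ → Placement t s p m′
swapPlacement π = record
  { label     = label ∘ swapVertex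
  ; injective = swapVertex-injective ∘ injective
  ; hits      = hits′
  }
  where
  open Placement π
  swapVertex-involutive : ∀ {s t p} (x : Vertex s t p) → swapVertex (swapVertex x) ≡ x
  swapVertex-involutive (left _)   = refl
  swapVertex-involutive (right _)  = refl
  swapVertex-involutive (centre _) = refl
  hits′ : ∀ k → _
  hits′ k with hits k
  ... | x , y , x≢y , clash , a , b , lx , ly , e = swapVertex x , swapVertex y ,
    x≢y ∘ swapVertex-injective , swapVertex-Clash x y clash , a , b ,
    trans (cong label (swapVertex-involutive x)) lx , trans (cong label (swapVertex-involutive y)) ly , e

-- The first sum not promised by `element-sums`, and also the next high element,
-- `element u (suc u + b)`.
top : ℕ → ℕ → ℕ
top u b = u + u + b * suc u

-- Left vertices get labels 2x and right ones 2y + o with o = 2w + 1. Left pairs take care of the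
-- cycles 1, ..., o; right pairs, with sums 1, ..., D shifted by o, take care of o + 1, ..., m,
-- where m is cycle 0 again.
module Place {u₀ v₀ m′ : ℕ} (w D b : ℕ)
  (left-covers : suc (w * 2) < top (suc u₀) u₀) (right-covers : D < top (suc v₀) b)
  (1≤D : 1 ≤ D) (D+o≡m : D + suc (w * 2) ≡ suc m′) (b≤v₀ : b ≤ v₀)
  (left-< : ∀ {i} → i < suc (suc u₀) + u₀ → element (suc u₀) i < suc m′)
  (right-< : ∀ {j} → j < suc (suc v₀) + b → element (suc v₀) j < suc m′) where

  open Walecki m′

  u v o : ℕ
  u = suc u₀
  v = suc v₀
  o = suc (w * 2)

  s t : ℕ
  s = suc u + u₀
  t = suc v + v₀

  raw : ℕ → ℕ
  raw i with i <? s
  ... | yes _ = element u i * 2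
  ... | no  _ = element v (i ∸ s) * 2 + o

  raw-left : ∀ {i} → i < s → raw i ≡ element u i * 2
  raw-left {i} i<s with i <? s
  ... | yes _  = refl
  ... | no i≮s = contradiction i<s i≮s

  raw-right : ∀ j → raw (s + j) ≡ element v j * 2 + o
  raw-right j with s + j <? s
  ... | yes s+j<s = contradiction s+j<s (≤⇒≯ (m≤m+n s j))
  ... | no  _     = cong (λ z → element v z * 2 + o) (m+n∸m≡n s j)

  -- The vertices with a prescribed label come first: all left ones and the first `suc v + b` right
  -- ones.
  special : ℕ
  special = s + (suc v + b)

  data SpecialView : ℕ → Set where
    left-special  : ∀ {i} → i < s → SpecialView i
    right-special : ∀ {j} → j < suc v + b → SpecialView (s + j)

  specialView : ∀ {i} → i < special → SpecialView i
  specialView {i} i< with <-≤-connex i s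
  ... | inj₁ i<s = left-special i<s
  ... | inj₂ s≤i = subst SpecialView (m+[n∸m]≡n s≤i)
    (right-special (+-cancelˡ-< s _ _ (subst (_< special) (sym (m+[n∸m]≡n s≤i)) i<)))

  -- As `n` is even, reduction modulo `n` keeps parity, and `o` is odd.
  left≢right : ∀ x y → x * 2 % n ≢ (y * 2 + o) % n
  left≢right x y eq = 0≢1+n (begin
    0                        ≡⟨ m*n%n≡0 x 2 ⟨
    x * 2 % 2                ≡⟨ m∣n⇒o%n%m≡o%m 2 n (x * 2) (divides m refl) ⟨
    x * 2 % n % 2            ≡⟨ cong (_% 2) eq ⟩
    (y * 2 + o) % n % 2      ≡⟨ m∣n⇒o%n%m≡o%m 2 n (y * 2 + o) (divides m refl) ⟩
    (y * 2 + o) % 2          ≡⟨ cong (_% 2) (regroup y w) ⟩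
    (1 + (y + w) * 2) % 2    ≡⟨ [m+kn]%n≡m%n 1 (y + w) 2 ⟩
    1                        ∎)
    where
    open ≡-Reasoning
    regroup : ∀ y w → y * 2 + suc (w * 2) ≡ 1 + (y + w) * 2
    regroup = solve-∀

  raw-injective : ∀ {i j} → i < special → j < special → raw i % n ≡ raw j % n → i ≡ j
  raw-injective i< j< eq with specialView i< | specialView j<
  ... | left-special {i} i<s | left-special {j} j<s = element-injective {u} (s≤s z≤n)
    (*-cancelʳ-≡ _ _ 2 (trans (sym (m<n⇒m%n≡m (*-monoˡ-< 2 (left-< i<s))))
      (trans (subst₂ (λ x y → x % n ≡ y % n) (raw-left i<s) (raw-left j<s) eq)
        (m<n⇒m%n≡m (*-monoˡ-< 2 (left-< j<s))))))
  ... | right-special {i} i<b | right-special {j} j<b = cong (s +_) (element-injective {v} (s≤s z≤n)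
    (*-cancelʳ-≡ _ _ 2 (%-+-cancelʳ o (*-monoˡ-< 2 (right-< i<b)) (*-monoˡ-< 2 (right-< j<b))
      (subst₂ (λ x y → x % n ≡ y % n) (raw-right i) (raw-right j) eq))))
  ... | left-special {i} i<s | right-special {j} j<b = contradiction
    (subst₂ (λ x y → x % n ≡ y % n) (raw-left i<s) (raw-right j) eq) (left≢right (element u i) (element v j))
  ... | right-special {i} i<b | left-special {j} j<s = contradiction
    (sym (subst₂ (λ x y → x % n ≡ y % n) (raw-right i) (raw-left j<s) eq))
    (left≢right (element u j) (element v i))

  raw-index : ∀ i j (k : Fin m) → (raw i + raw j ≡ toℕ k * 2) ⊎ (raw i + raw j ≡ toℕ k * 2 + n) →
              index (suc (raw i mod n)) (suc (raw j mod n)) ≡ k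
  raw-index i j k sum = Fin.toℕ-injective (begin
    toℕ (index (suc (raw i mod n)) (suc (raw j mod n)))  ≡⟨ Fin.toℕ-fromℕ< _ ⟩
    (toℕ (raw i mod n) + toℕ (raw j mod n)) % n / 2
      ≡⟨ cong₂ (λ x y → (x + y) % n / 2) (Fin.toℕ-fromℕ< (m%n<n (raw i) n)) (Fin.toℕ-fromℕ< (m%n<n (raw j) n)) ⟩
    (raw i % n + raw j % n) % n / 2  ≡⟨ cong (_/ 2) (%-distribˡ-+ (raw i) (raw j) n) ⟨
    (raw i + raw j) % n / 2          ≡⟨ cong (_/ 2) (reduce sum) ⟩
    toℕ k * 2 / 2                    ≡⟨ m*n/n≡m (toℕ k) 2 ⟩
    toℕ k                            ∎)
    where
    open ≡-Reasoning
    small : toℕ k * 2 % n ≡ toℕ k * 2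
    small = m<n⇒m%n≡m (*-monoˡ-< 2 (Fin.toℕ<n k))
    reduce : ∀ {x} → (x ≡ toℕ k * 2) ⊎ (x ≡ toℕ k * 2 + n) → x % n ≡ toℕ k * 2
    reduce (inj₁ refl) = small
    reduce (inj₂ refl) = trans ([m+n]%n≡m%n (toℕ k * 2) n) small

  Hit : Fin m → Set
  Hit k = (∃₂ λ i j → i ≢ j × i < s × j < s × index (suc (raw i mod n)) (suc (raw j mod n)) ≡ k)
        ⊎ (∃₂ λ i j → i ≢ j × i < suc v + b × j < suc v + b ×
             index (suc (raw (s + i) mod n)) (suc (raw (s + j) mod n)) ≡ k)

  left-hit : ∀ k → 1 ≤ toℕ k → toℕ k ≤ o → Hit k
  left-hit k 1≤k k≤o with element-sums {u} {u₀} 1≤k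
    (≤-<-trans k≤o left-covers)
  ... | i , j , i≢j , i<s , j<s , sum = inj₁ (i , j , i≢j , i<s , j<s , raw-index i j k (inj₁ (begin
    raw i + raw j                      ≡⟨ cong₂ _+_ (raw-left i<s) (raw-left j<s) ⟩
    element u i * 2 + element u j * 2  ≡⟨ *-distribʳ-+ 2 (element u i) (element u j) ⟨
    (element u i + element u j) * 2    ≡⟨ cong (_* 2) sum ⟩
    toℕ k * 2                          ∎)))
    where
    open ≡-Reasoning

  right-hit : ∀ k τ → 1 ≤ τ → τ ≤ D → (τ + o ≡ toℕ k) ⊎ (τ + o ≡ toℕ k + m) → Hit k
  right-hit k τ 1≤τ τ≤D total with element-sums {v} {b} 1≤τ (≤-<-trans τ≤D right-covers)
  ... | i , j , i≢j , i< , j< , sum = inj₂ (i , j , i≢j , i< , j< , raw-index (s + i) (s + j) k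
    (Sum⊎.map (λ e → trans raw-sum (cong (_* 2) e))
      (λ e → trans raw-sum (trans (cong (_* 2) e) (*-distribʳ-+ 2 (toℕ k) m))) total))
    where
    open ≡-Reasoning
    regroup : ∀ x y o → (x * 2 + o) + (y * 2 + o) ≡ (x + y + o) * 2
    regroup = solve-∀
    raw-sum : raw (s + i) + raw (s + j) ≡ (τ + o) * 2
    raw-sum = begin
      raw (s + i) + raw (s + j)                    ≡⟨ cong₂ _+_ (raw-right i) (raw-right j) ⟩
      element v i * 2 + o + (element v j * 2 + o)  ≡⟨ regroup (element v i) (element v j) o ⟩
      (element v i + element v j + o) * 2          ≡⟨ cong (λ z → (z + o) * 2) sum ⟩
      (τ + o) * 2                                  ∎

  hit : ∀ k → Hit k
  hit k with ≤-<-connex (toℕ k) o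
  -- Sums from `element-sums` start at 1, so cycle 0 is reached as `D + o = m`.
  hit zero    | inj₁ _ = right-hit zero D 1≤D ≤-refl (inj₂ D+o≡m)
  hit (suc k) | inj₁ k≤o = left-hit (suc k) (s≤s z≤n) k≤o
  ... | inj₂ o<k = right-hit k (toℕ k ∸ o) (m<n⇒0<n∸m o<k)
    (subst (toℕ k ∸ o ≤_) (trans (cong (_∸ o) (sym D+o≡m)) (m+n∸n≡m D o))
      (∸-monoˡ-≤ o (<⇒≤ (Fin.toℕ<n k))))
    (inj₁ (m∸n+n≡m (<⇒≤ o<k)))

  special≤ : special ≤ s + t
  special≤ = +-monoʳ-≤ s (+-monoʳ-≤ (suc v) b≤v₀)

  module _ {p : ℕ} (order : s + t + p ≡ suc n) where

    initial : ℕ → Label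
    initial i = suc (raw i mod n)

    special≤1+n : special ≤ suc n
    special≤1+n = ≤-trans special≤ (subst (s + t ≤_) order (m≤m+n (s + t) p))

    extended = extend-injection (suc n ∸ special) special initial (m∸n+n≡m special≤1+n)
      (λ {i} {j} i< j< eq → raw-injective i< j< (begin
        raw i % n              ≡⟨ Fin.toℕ-fromℕ< (m%n<n (raw i) n) ⟨
        toℕ (raw i mod n)      ≡⟨ cong toℕ (Fin.suc-injective eq) ⟩
        toℕ (raw j mod n)      ≡⟨ Fin.toℕ-fromℕ< (m%n<n (raw j) n) ⟩
        raw j % n              ∎))
      where open ≡-Reasoning

    label : Vertex s t p → Label
    label x = proj₁ extended (position x)

    label-special : ∀ x → position x < special → label x ≡ initial (position x)
    label-special x = proj₂ (proj₂ extended) (position x)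

    position<1+n : (x : Vertex s t p) → position x < suc n
    position<1+n x = subst (position x <_) order (position-< x)

    realise : ∀ k → Hit k → ∃₂ λ x y → x ≢ y × Clash x y ×
              ∃₂ λ a b → label x ≡ suc a × label y ≡ suc b × index (suc a) (suc b) ≡ k
    realise k (inj₁ (i , j , i≢j , i<s , j<s , e)) = x , y ,
      i≢j ∘ (λ x≡y → trans (sym posx) (trans (cong position x≡y) posy)) , Unit.tt , _ , _ ,
      trans (label-special x (subst (_< special) (sym posx) (<-≤-trans i<s (m≤m+n s _)))) (cong initial posx) ,
      trans (label-special y (subst (_< special) (sym posy) (<-≤-trans j<s (m≤m+n s _)))) (cong initial posy) ,
      e
      where
      x y : Vertex s t p
      x = left (fromℕ< i<s)
      y = left (fromℕ< j<s)
      posx : position x ≡ i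
      posx = Fin.toℕ-fromℕ< i<s
      posy : position y ≡ j
      posy = Fin.toℕ-fromℕ< j<s
    realise k (inj₂ (i , j , i≢j , i< , j< , e)) = x , y ,
      i≢j ∘ (λ x≡y → +-cancelˡ-≡ s _ _ (trans (sym posx) (trans (cong position x≡y) posy))) , Unit.tt , _ , _ ,
      trans (label-special x (subst (_< special) (sym posx) (+-monoʳ-< s i<))) (cong initial posx) ,
      trans (label-special y (subst (_< special) (sym posy) (+-monoʳ-< s j<))) (cong initial posy) ,
      e
      where
      i<t = <-≤-trans i< (+-cancelˡ-≤ s _ _ special≤)
      j<t = <-≤-trans j< (+-cancelˡ-≤ s _ _ special≤)
      x y : Vertex s t p
      x = right (fromℕ< i<t)
      y = right (fromℕ< j<t)
      posx : position x ≡ s + i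
      posx = cong (s +_) (Fin.toℕ-fromℕ< i<t)
      posy : position y ≡ s + j
      posy = cong (s +_) (Fin.toℕ-fromℕ< j<t)

    placement : Placement s t p m′
    placement = record
      { label     = label
      ; injective = λ {x} {y} eq → position-injective
          (proj₁ (proj₂ extended) (position<1+n x) (position<1+n y) eq)
      ; hits      = λ k → realise k (hit k)
      }

-- This is m - 1: with u = u₀ + 1 and v = v₀ + 1, classes of 2u, 2v and 4uv - 1 vertices have 2m + 1
-- vertices in all for m = 2uv + u + v - 1.
half : ℕ → ℕ → ℕ
half u₀ v₀ = 2 * (suc u₀ * suc v₀) + (u₀ + v₀)

half-comm : ∀ u₀ v₀ → half u₀ v₀ ≡ half v₀ u₀
half-comm = identity
  where
  identity : ∀ u v → 2 * (suc u * suc v) + (u + v) ≡ 2 * (suc v * suc u) + (v + u)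
  identity = solve-∀

-- Here `d` is v₀ - u₀: the smaller class goes to the left, where every element is used and must
-- stay below m.
module Parameters (u₀ d : ℕ) (nontrivial : 1 ≤ u₀ + d) where

  v₀ u v m′ m : ℕ
  v₀ = u₀ + d
  u  = suc u₀
  v  = suc v₀
  m′ = half u₀ v₀
  m  = suc m′

  -- The left elements cover the sums from 1 to c + 1.
  c w o : ℕ
  c = u₀ * (u₀ + 4)
  w = c / 2
  o = suc (w * 2)

  -- `o` is the odd one of `c` and `c + 1`, so at most one of the sums covered on the left is given
  -- up for parity.
  c≤o : c ≤ o
  c≤o = begin
    c              ≡⟨ m≡m%n+[m/n]*n c 2 ⟩
    c % 2 + w * 2  ≤⟨ +-monoˡ-≤ (w * 2) (≤-pred (m%n<n c 2)) ⟩
    o              ∎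
    where open ≤-Reasoning

  o≤1+c : o ≤ suc c
  o≤1+c = s≤s (m/n*n≤m c 2)

  -- Writing the larger parameter as u₀ + d makes the slack a polynomial with non-negative
  -- coefficients, so the inequality becomes an identity. It keeps the left elements below `m` and
  -- `o` below `m`.
  2+c≤m : 2 + c ≤ m
  2+c≤m = m+n≤o⇒m≤o (2 + c) (≤-reflexive (identity u₀ d))
    where
    identity : ∀ u d → 2 + u * (u + 4) + (u * u + 2 * u * d + 2 * u + 3 * d + 1) ≡
               suc (2 * (suc u * suc (u + d)) + (u + (u + d)))
    identity = solve-∀

  o<m : o < m
  o<m = <-≤-trans (s≤s o≤1+c) 2+c≤m

  left-top : top u u₀ ≡ 2 + c
  left-top = identity u₀
    where
    identity : ∀ u → suc u + suc u + u * suc (suc u) ≡ 2 + u * (u + 4)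
    identity = solve-∀

  -- This amounts to (v − u)² + u + v > 2, which fails only for u = v = 1.
  fits : ∀ u₀ d → 1 ≤ u₀ + d → let v₀ = u₀ + d; v = suc v₀ in
         suc (2 * (suc u₀ * v) + (u₀ + v₀)) < u₀ * (u₀ + 4) + (v + v + v₀ * suc v)
  fits u₀ (suc d) _ = m+n≤o⇒m≤o _ (≤-reflexive (identity u₀ d))
    where
    identity : ∀ u d → suc (suc (2 * (suc u * suc (u + suc d)) + (u + (u + suc d)))) + (d * d + 3 * d + 2 * u) ≡
               u * (u + 4) + (suc (u + suc d) + suc (u + suc d) + (u + suc d) * suc (suc (u + suc d)))
    identity = solve-∀
  fits (suc u) zero _ = m+n≤o⇒m≤o _ (≤-reflexive (identity u))
    where
    identity : ∀ u → suc (suc (2 * (suc (suc u) * suc (suc u + 0)) + (suc u + (suc u + 0)))) + 2 * u ≡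
               suc u * (suc u + 4) + (suc (suc u + 0) + suc (suc u + 0) + (suc u + 0) * suc (suc (suc u + 0)))
    identity = solve-∀

  D : ℕ
  D = m ∸ o

  D+o≡m : D + o ≡ m
  D+o≡m = m∸n+n≡m (<⇒≤ o<m)

  D<top : D < top v v₀
  D<top = +-cancelʳ-< o D (top v v₀) (begin-strict
    D + o           ≡⟨ D+o≡m ⟩
    m               <⟨ fits u₀ d nontrivial ⟩
    c + top v v₀    ≤⟨ +-monoˡ-≤ (top v v₀) c≤o ⟩
    o + top v v₀    ≡⟨ +-comm o _ ⟩
    top v v₀ + o    ∎)
    where open ≤-Reasoning

  -- With all `v₀` high elements the labels could pass `m` and collide. The least sufficient number
  -- `b` keeps every high element in use at most `D`, hence below `m`.
  chosen = least D (top v) (λ i≤j → +-monoʳ-≤ (v + v) (*-monoˡ-≤ (suc v) i≤j)) v₀ D<top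

  b : ℕ
  b = proj₁ chosen

  b≤v₀ : b ≤ v₀
  b≤v₀ = proj₁ (proj₂ chosen)

  D<top-b : D < top v b
  D<top-b = proj₁ (proj₂ (proj₂ chosen))

  below-b : ∀ j → j < b → top v j < m
  below-b j j<b = ≤-<-trans (proj₂ (proj₂ (proj₂ chosen)) j j<b) (m∸n<m m′ (w * 2))
    where
    m∸n<m : ∀ a b → a ∸ b < suc a
    m∸n<m a b = s≤s (m∸n≤m a b)

  v<m : v < m
  v<m = s≤s (m+n≤o⇒m≤o v (≤-reflexive (identity u₀ d)))
    where
    identity : ∀ u d → suc (u + d) + ((2 * u + 1) * suc (u + d) + (u + (u + d))) ≡
               2 * (suc u * suc (u + d)) + (u + (u + d))
    identity = solve-∀

  u<m : u < m
  u<m = ≤-<-trans (s≤s (m≤m+n u₀ d)) v<m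

  left-< : ∀ {i} → i < suc u + u₀ → element u i < m
  left-< {i} i<s = element-< {u} {u₀} u<m
    (λ j j<u₀ → <-≤-trans (+-monoʳ-< (u + u) (*-monoˡ-< (suc u) j<u₀))
      (≤-trans (≤-reflexive left-top) 2+c≤m))
    i<s

  right-< : ∀ {j} → j < suc v + b → element v j < m
  right-< = element-< v<m below-b

  open Place {u₀} {v₀} {m′} w D b (subst (o <_) (sym left-top) (s≤s o≤1+c)) D<top-b
    (m<n⇒0<n∸m o<m) D+o≡m b≤v₀ left-< right-< public using (s; t; placement)

-- Edge colourings and degrees

Selection : ∀ {N q} → (Fin N → Set q) → ℕ → Set q
Selection {N} Q d = Σ (Fin d → Fin N) λ e →
  (∀ {i j} → e i ≡ e j → i ≡ j) × (∀ i → Q (e i)) × (∀ j → Q j → ∃ λ i → e i ≡ j)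

select : ∀ {N q} {Q : Fin N → Set q} → Decidable Q → ∃ (Selection Q)
select {zero}  Q? = 0 , (λ ()) , (λ { {()} }) , (λ ()) , (λ ())
select {suc N} {Q = Q} Q? with Q? zero | select {Q = Q ∘ suc} (Q? ∘ suc)
... | no ¬q₀ | d , e , e-inj , sound , complete =
  d , suc ∘ e , e-inj ∘ Fin.suc-injective , sound , complete′
  where
  complete′ : ∀ j → Q j → ∃ λ i → suc (e i) ≡ j
  complete′ zero    q₀ = contradiction q₀ ¬q₀
  complete′ (suc j) q  = let i , eq = complete j q in i , cong suc eq
... | yes q₀ | d , e , e-inj , sound , complete =
  suc d , e′ , e′-inj , (λ { zero → q₀ ; (suc i) → sound i }) , complete′
  where
  e′ : Fin (suc d) → Fin (suc N)
  e′ zero    = zero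
  e′ (suc i) = suc (e i)
  e′-inj : ∀ {i j} → e′ i ≡ e′ j → i ≡ j
  e′-inj {zero}  {zero}  _  = refl
  e′-inj {suc i} {suc j} eq = cong suc (e-inj (Fin.suc-injective eq))
  complete′ : ∀ j → Q j → ∃ λ i → e′ i ≡ j
  complete′ zero    _ = zero , refl
  complete′ (suc j) q = let i , eq = complete j q in suc i , cong suc eq

module Enumerated {v e a} (G : SimpleGraph v e a) {N} (enum : HasSize (SimpleGraph.vertices G) N) where
  open SimpleGraph G
  private module ≈ = Setoid vertices
  open Inverse enum public using () renaming
    ( to to at; from to index; strictlyInverseˡ to at-index
    ; strictlyInverseʳ to index-at; from-cong to index-cong )

  index-injective : ∀ {x y} → index x ≡ index y → x ≈ᵛ y
  index-injective {x} {y} eq = ≈.trans (≈.sym (at-index x)) (≈.trans (≈.reflexive (cong at eq)) (at-index y))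

  at-injective : ∀ {i j} → at i ≈ᵛ at j → i ≡ j
  at-injective eq = trans (sym (index-at _)) (trans (index-cong eq) (index-at _))

  HasDegree-unique : ∀ {x d d′} → HasDegree G x d → HasDegree G x d′ → d ≡ d′
  HasDegree-unique deg deg′ = Perm.↔⇒≡ (Composition.inverse deg (Symmetry.inverse deg′))

  select-degree : ∀ {x d} → Selection (λ i → x ~ at i) d → HasDegree G x d
  select-degree {x} (e , e-inj , sound , complete) = record
    { to        = λ i → at (e i) , sound i
    ; from      = place
    ; to-cong   = λ { refl → ≈.refl }
    ; from-cong = λ {y} {y′} y≈y′ →
        e-inj (trans (place-index y) (trans (index-cong y≈y′) (sym (place-index y′))))
    ; inverse   = (λ { {n} refl → ≈.trans (≈.reflexive (cong at (place-index n))) (at-index (proj₁ n)) })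
                , λ {i} {n} y≈ → e-inj (trans (place-index n) (trans (index-cong y≈) (index-at (e i))))
    }
    where
    found : (n : Σ V (x ~_)) → ∃ λ i → e i ≡ index (proj₁ n)
    found (y , x~y) = complete (index y) (~-resp ≈.refl (≈.sym (at-index y)) x~y)
    place : Σ V (x ~_) → Fin _
    place n = proj₁ (found n)
    place-index : ∀ n → e (place n) ≡ index (proj₁ n)
    place-index n = proj₂ (found n)

module _ {v e a} (G : SimpleGraph v e a) {n} (enum : HasSize (SimpleGraph.vertices G) (suc n)) where
  open SimpleGraph G
  open Enumerated G enum
  private module ≈ = Setoid vertices

  degree≤ : (~-dec : ∀ x y → Dec (x ~ y)) → ∀ x → ∃ λ d → HasDegree G x d × d ≤ n
  degree≤ ~-dec x with select (λ i → ~-dec x (at i))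
  ... | d , s@(e , e-inj , sound , _) = d , select-degree s ,
    Fin.injective⇒≤ {f = λ i → Fin.punchOut (avoids i)}
    (λ {i} {j} eq → e-inj (Fin.punchOut-injective (avoids i) (avoids j) eq))
    where
    avoids : ∀ i → index x ≢ e i
    avoids i eq = ~-irrefl (≈.trans (≈.sym (at-index x)) (≈.reflexive (cong at eq))) (sound i)

  Dominating : V → Set _
  Dominating x = ∀ y → ¬ x ≈ᵛ y → x ~ y

  dominating-degree : ∀ {x} → Dominating x → HasDegree G x n
  dominating-degree {x} dom = select-degree
    ( Fin.punchIn (index x) , Fin.punchIn-injective (index x) _ _
    , (λ i → dom _ λ x≈ → Fin.punchInᵢ≢i (index x) i (sym (trans (index-cong x≈) (index-at _))))
    , λ j x~j → let x≢j = λ eq → ~-irrefl (≈.trans (≈.sym (at-index x)) (≈.reflexive (cong at eq))) x~j in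
        Fin.punchOut x≢j , Fin.punchIn-punchOut x≢j )

  dominating⇒IsMaxDegree : (∀ x y → Dec (x ~ y)) → ∀ {x} → Dominating x → IsMaxDegree G n
  dominating⇒IsMaxDegree ~-dec {x} dom = degree≤ ~-dec , x , dominating-degree dom

  dominating⇒≤Δ : ∀ {x Δ} → Dominating x → IsMaxDegree G Δ → n ≤ Δ
  dominating⇒≤Δ {x} dom (bounded , _) with bounded x
  ... | d , deg , d≤Δ = subst (_≤ _) (HasDegree-unique deg (dominating-degree dom)) d≤Δ

  -- Colouring an edge by the sum of its indices modulo the number of vertices is proper for any
  -- graph. Beside a dominating vertex this is the bound Δ + 1, without Vizing's theorem.
  cyclic-colouring : EdgeColouring G (suc n)
  cyclic-colouring = record
    { colour      = λ {x} {y} _ → sum x y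
    ; colour-cong = λ x≈ y≈ _ _ → cong₂ (λ i j → (toℕ i + toℕ j) mod suc n) (index-cong x≈) (index-cong y≈)
    ; colour-sym  = λ {x} {y} _ → cong (_mod suc n) (+-comm (toℕ (index y)) (toℕ (index x)))
    ; proper      = λ {x} {y} {z} _ _ y≉z eq → y≉z (index-injective (Fin.toℕ-injective
        (%-+-cancelʳ (toℕ (index x)) (Fin.toℕ<n (index y)) (Fin.toℕ<n (index z))
          (trans (toℕ-sum y x) (trans (cong toℕ eq) (sym (toℕ-sum z x)))))))
    }
    where
    sum : V → V → Fin (suc n)
    sum x y = (toℕ (index x) + toℕ (index y)) mod suc n
    toℕ-sum : ∀ y x → (toℕ (index y) + toℕ (index x)) % suc n ≡ toℕ (sum x y)
    toℕ-sum y x = trans (cong (_% suc n) (+-comm (toℕ (index y)) _))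
      (sym (Fin.toℕ-fromℕ< (m%n<n (toℕ (index x) + toℕ (index y)) (suc n))))

-- Involutions on sets of odd size

module _ where
  open Sum +-0-commutativeMonoid using (sum; sum-permute; ∑-distrib-+; sum-cong-≗)

  private
    sum-1 : ∀ n → sum {n} (λ _ → 1) ≡ n
    sum-1 zero    = refl
    sum-1 (suc n) = cong suc (sum-1 n)

    less : ℕ → ℕ → ℕ
    less i j with i <? j
    ... | yes _ = 1
    ... | no  _ = 0

    less+less : ∀ {i j} → i ≢ j → less i j + less j i ≡ 1
    less+less {i} {j} i≢j with i <? j | j <? i
    ... | yes i<j | yes j<i = contradiction i<j (<-asym j<i)
    ... | yes _   | no  _   = refl
    ... | no  _   | yes _   = refl
    ... | no i≮j  | no j≮i  = contradiction (≤-antisym (≮⇒≥ j≮i) (≮⇒≥ i≮j)) i≢j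

  -- Without fixed points the ascents i < f i and the descents f i < i would
  -- partition an odd set, while f exchanges them.
  involution-fixes : ∀ m (f : Fin (suc (m + m)) → Fin (suc (m + m))) → (∀ i → f (f i) ≡ i) →
                     ∃ λ i → f i ≡ i
  involution-fixes m f f-inv with Fin.any? (λ i → f i Fin.≟ i)
  ... | yes fixed = fixed
  ... | no ¬fixed = contradiction (begin
    suc (m + m)                                    ≡⟨ sum-1 (suc (m + m)) ⟨
    sum (λ (i : Fin (suc (m + m))) → 1)            ≡⟨ sum-cong-≗ (λ i → less+less {toℕ i} {toℕ (f i)}
                                                        (λ eq → ¬fixed (i , Fin.toℕ-injective (sym eq)))) ⟨
    sum (λ i → ascent i + descent i)               ≡⟨ ∑-distrib-+ ascent descent ⟩
    sum ascent + sum descent                       ≡⟨ cong (sum ascent +_) (sum-cong-≗ λ i →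
                                                        cong (less (toℕ (f i)) ∘ toℕ) (f-inv i)) ⟨
    sum ascent + sum (ascent ∘ f)                  ≡⟨ cong (sum ascent +_) (sum-permute ascent
                                                        (Perm.permutation f f f-inv f-inv)) ⟨
    sum ascent + sum ascent                        ∎) (odd≢even m (sum ascent))
    where
    open ≡-Reasoning
    ascent descent : Fin (suc (m + m)) → ℕ
    ascent i = less (toℕ i) (toℕ (f i))
    descent i = less (toℕ (f i)) (toℕ i)

-- Graphs determined by their clashes

record Represents {v e a} (G : SimpleGraph v e a) (s t p : ℕ) : Set (v ⊔ e ⊔ a) where
  open SimpleGraph G
  field
    encode           : V → Vertex s t p
    decode           : Vertex s t p → V
    encode-cong      : ∀ {x y} → x ≈ᵛ y → encode x ≡ encode y
    encode-injective : ∀ {x y} → encode x ≡ encode y → x ≈ᵛ y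
    encode-decode    : ∀ x → encode (decode x) ≡ x
    ~⇒¬Clash         : ∀ {x y} → x ~ y → ¬ Clash (encode x) (encode y)
    ¬Clash⇒~         : ∀ {x y} → ¬ x ≈ᵛ y → ¬ Clash (encode x) (encode y) → x ~ y

Clash? : ∀ {s t p} (x y : Vertex s t p) → Dec (Clash x y)
Clash? (left _)   (left _)   = yes Unit.tt
Clash? (left _)   (right _)  = no λ ()
Clash? (left _)   (centre _) = no λ ()
Clash? (right _)  (left _)   = no λ ()
Clash? (right _)  (right _)  = yes Unit.tt
Clash? (right _)  (centre _) = no λ ()
Clash? (centre _) _          = no λ ()

Clash-sym : ∀ {s t p} (x y : Vertex s t p) → Clash x y → Clash y x
Clash-sym (left _)  (left _)  _ = Unit.tt
Clash-sym (right _) (right _) _ = Unit.tt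

vertexAt : ∀ {s t p} → Fin (s + t + p) → Vertex s t p
vertexAt {s} {t} = Sum⊎.map₁ (Fin.splitAt s) ∘ Fin.splitAt (s + t)

vertexIndex : ∀ {s t p} → Vertex s t p → Fin (s + t + p)
vertexIndex {s} {t} {p} = Fin.join (s + t) p ∘ Sum⊎.map₁ (Fin.join s t)

vertexAt-index : ∀ {s t p} (x : Vertex s t p) → vertexAt (vertexIndex x) ≡ x
vertexAt-index {s} {t} {p} x = trans
  (cong (Sum⊎.map₁ (Fin.splitAt s)) (Fin.splitAt-join (s + t) p (Sum⊎.map₁ (Fin.join s t) x))) (split x)
  where
  split : ∀ (x : Vertex s t p) → Sum⊎.map₁ (Fin.splitAt s) (Sum⊎.map₁ (Fin.join s t) x) ≡ x
  split (inj₁ y) = cong inj₁ (Fin.splitAt-join s t y)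
  split (inj₂ _) = refl

vertexIndex-at : ∀ {s t p} (i : Fin (s + t + p)) → vertexIndex {s} {t} {p} (vertexAt i) ≡ i
vertexIndex-at {s} {t} {p} i = trans (cong (Fin.join (s + t) p) (joined (Fin.splitAt (s + t) i)))
  (Fin.join-splitAt (s + t) p i)
  where
  joined : ∀ (y : Fin (s + t) ⊎ Fin p) → Sum⊎.map₁ (Fin.join s t) (Sum⊎.map₁ (Fin.splitAt s) y) ≡ y
  joined (inj₁ y) = cong inj₁ (Fin.join-splitAt s t y)
  joined (inj₂ _) = refl

module Represented {v e a} (G : SimpleGraph v e a) {s t p} (rep : Represents G s t p) where
  open SimpleGraph G
  open Represents rep
  private module ≈ = Setoid vertices

  enumeration : HasSize vertices (s + t + p)
  enumeration = record
    { to        = decode ∘ vertexAt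
    ; from      = vertexIndex ∘ encode
    ; to-cong   = λ { refl → ≈.refl }
    ; from-cong = cong vertexIndex ∘ encode-cong
    ; inverse   = (λ { {x} refl → encode-injective (trans (encode-decode _) (vertexAt-index (encode x))) })
                , (λ {i} {x} x≈ → trans (cong vertexIndex (trans (encode-cong x≈) (encode-decode (vertexAt i))))
                    (vertexIndex-at {s} {t} {p} i))
    }

  centre-~ : ∀ l y → ¬ decode (centre l) ≈ᵛ y → decode (centre l) ~ y
  centre-~ l y ≉ = ¬Clash⇒~ ≉ (subst (λ x → ¬ Clash x (encode y)) (sym (encode-decode (centre l))) λ ())

  ~-dec : ∀ x y → Dec (x ~ y)
  ~-dec x y with Clash? (encode x) (encode y)
  ... | yes clash = no λ x~y → ~⇒¬Clash x~y clash
  ... | no ¬clash with vertexIndex (encode x) Fin.≟ vertexIndex (encode y)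
  ... | yes eq = no (~-irrefl (encode-injective (trans (sym (vertexAt-index (encode x)))
    (trans (cong vertexAt eq) (vertexAt-index (encode y))))))
  ... | no ≢   = yes (¬Clash⇒~ (≢ ∘ cong vertexIndex ∘ encode-cong) ¬clash)

  -- The colouring of the complete graph repeats a colour at a vertex only if one of the two edges
  -- is the gap of its cycle, and the placement puts a clashing pair, hence a non-edge, on every
  -- gap.
  placed-colouring : ∀ {m′} → Placement s t p m′ → EdgeColouring G (suc m′ * 2)
  placed-colouring {m′} π = record
    { colour      = λ {x} {y} _ → colour (place x) (place y)
    ; colour-cong = λ x≈ y≈ _ _ → cong₂ colour (cong label (encode-cong x≈)) (cong label (encode-cong y≈))
    ; colour-sym  = λ {x} {y} _ → colour-sym (place y) (place x)
    ; proper      = λ x~y x~z y≉z eq → [ gap-clashes x~y , gap-clashes x~z ]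
        (colour-proper (~⇒≢ x~y) (~⇒≢ x~z) (y≉z ∘ encode-injective ∘ injective) eq)
    }
    where
    open Placement π
    open Walecki m′ using (m; n; Label)
    x′ y′ : Fin m → Vertex s t p
    x′ k = proj₁ (hits k)
    y′ k = proj₁ (proj₂ (hits k))
    x′≢y′ : ∀ k → x′ k ≢ y′ k
    x′≢y′ k = proj₁ (proj₂ (proj₂ (hits k)))
    clash : ∀ k → Clash (x′ k) (y′ k)
    clash k = proj₁ (proj₂ (proj₂ (proj₂ (hits k))))
    b b′ : Fin m → Fin n
    b k = proj₁ (proj₂ (proj₂ (proj₂ (proj₂ (hits k)))))
    b′ k = proj₁ (proj₂ (proj₂ (proj₂ (proj₂ (proj₂ (hits k))))))
    labels : ∀ k → _
    labels k = proj₂ (proj₂ (proj₂ (proj₂ (proj₂ (proj₂ (hits k))))))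
    label-x′ : ∀ k → label (x′ k) ≡ suc (b k)
    label-x′ k = proj₁ (labels k)
    label-y′ : ∀ k → label (y′ k) ≡ suc (b′ k)
    label-y′ k = proj₁ (proj₂ (labels k))
    open Walecki.Coloured m′ b b′
      (λ k eq → x′≢y′ k (injective (trans (label-x′ k) (trans (cong suc eq) (sym (label-y′ k))))))
      (λ k → proj₂ (proj₂ (labels k)))
    place : V → Label
    place = label ∘ encode
    ~⇒≢ : ∀ {x y} → x ~ y → place x ≢ place y
    ~⇒≢ x~y eq = ~-irrefl (encode-injective (injective eq)) x~y
    gap-clashes : ∀ {x y} → x ~ y → ¬ Gap (place x) (place y)
    gap-clashes x~y (k , inj₁ (ex , ey)) = ~⇒¬Clash x~y (subst₂ Clash
      (injective (trans (label-x′ k) (sym ex))) (injective (trans (label-y′ k) (sym ey))) (clash k))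
    gap-clashes x~y (k , inj₂ (ex , ey)) = ~⇒¬Clash x~y (subst₂ Clash
      (injective (trans (label-y′ k) (sym ex))) (injective (trans (label-x′ k) (sym ey)))
      (Clash-sym (x′ k) (y′ k) (clash k)))

-- Sending matched elements to their partners and the others to themselves is an involution; on a
-- set of odd size it has a fixed point, which cannot be matched.
odd⇒unmatched : ∀ m {q} {S : Fin (suc (m + m)) → Fin (suc (m + m)) → Set q} → (∀ i j → Dec (S i j)) →
                (∀ {i j} → S i j → S j i) → (∀ {i j k} → S i j → S i k → j ≡ k) → (∀ {i} → ¬ S i i) →
                ∃ λ i → ∀ j → ¬ S i j
odd⇒unmatched m {S = S} S? S-sym S-unique S-irrefl = conclude (involution-fixes m partner involutive)
  where
  partnerOf : ∀ {i} → Dec (∃ (S i)) → Fin (suc (m + m))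
  partnerOf     (yes (j , _)) = j
  partnerOf {i} (no _)        = i
  partner : Fin (suc (m + m)) → Fin (suc (m + m))
  partner i = partnerOf (Fin.any? (S? i))
  partnerOf-S : ∀ {i j} → S i j → (dec : Dec (∃ (S i))) → partnerOf dec ≡ j
  partnerOf-S s (yes (_ , s′)) = S-unique s′ s
  partnerOf-S s (no ¬s)        = contradiction (_ , s) ¬s
  partnerOf-involutive : ∀ i (dec : Dec (∃ (S i))) → dec ≡ Fin.any? (S? i) → partner (partnerOf dec) ≡ i
  partnerOf-involutive i (yes (j , s)) _  = partnerOf-S (S-sym s) (Fin.any? (S? j))
  partnerOf-involutive i (no _)        eq = cong partnerOf (sym eq)
  involutive : ∀ i → partner (partner i) ≡ i
  involutive i = partnerOf-involutive i (Fin.any? (S? i)) refl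
  conclude : (∃ λ i → partner i ≡ i) → ∃ λ i → ∀ j → ¬ S i j
  conclude (i , fixed) = i , λ j s →
    S-irrefl (subst (S i) (trans (sym (partnerOf-S s (Fin.any? (S? i)))) fixed) s)

-- As 7 is odd, every colour misses a vertex; but only the four outer vertices
-- miss a colour, and each of these misses just one.
module SixColours {v e a} (G : SimpleGraph v e a) (rep : Represents G 2 2 3)
                  (colouring : EdgeColouring G 6) where
  open SimpleGraph G
  open Represents rep
  open Represented G rep
  open Enumerated G enumeration
  open EdgeColouring colouring
  private module ≈ = Setoid vertices

  Sees : Fin 7 → Fin 6 → Fin 7 → Set _
  Sees i c j = Σ (at i ~ at j) λ i~j → colour i~j ≡ c

  sees? : ∀ i c j → Dec (Sees i c j)
  sees? i c j with ~-dec (at i) (at j)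
  ... | no ¬i~j = no λ (i~j , _) → ¬i~j i~j
  ... | yes i~j with colour i~j Fin.≟ c
  ... | yes eq = yes (i~j , eq)
  ... | no ≢c  = no λ (i~j′ , eq) → ≢c (trans (colour-cong ≈.refl ≈.refl i~j i~j′) eq)

  sees-unique : ∀ {i c j k} → Sees i c j → Sees i c k → j ≡ k
  sees-unique {j = j} {k} (p , eq) (q , eq′) with j Fin.≟ k
  ... | yes j≡k = j≡k
  ... | no j≢k  = contradiction (trans eq (sym eq′)) (proper p q (j≢k ∘ at-injective))

  sees-sym : ∀ {i c j} → Sees i c j → Sees j c i
  sees-sym (p , eq) = ~-sym p , trans (colour-sym p) eq

  missed : ∀ c → ∃ λ i → ∀ j → ¬ Sees i c j
  missed c = odd⇒unmatched 3 (λ i j → sees? i c j)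
    (λ {i} {j} → sees-sym {i} {c} {j}) (λ {i} {j} {k} → sees-unique {i} {c} {j} {k})
    (λ (p , _) → ~-irrefl ≈.refl p)

  Misses : Vertex 2 2 3 → Fin 6 → Set _
  Misses x c = ∀ y (x~y : decode x ~ y) → colour x~y ≢ c

  missed-vertex : ∀ c → ∃ λ x → Misses x c
  missed-vertex c = conclude (missed c)
    where
    conclude : (∃ λ i → ∀ j → ¬ Sees i c j) → ∃ λ x → Misses x c
    conclude (i , ¬s) = vertexAt i , λ y x~y eq →
      let r = ~-resp ≈.refl (≈.sym (at-index y)) x~y in
      ¬s (index y) (r , trans (colour-cong ≈.refl (at-index y) r x~y) eq)

  Star : Vertex 2 2 3 → ℕ → Set
  Star x d = Σ (Fin d → Vertex 2 2 3) λ f → Injective _≡_ _≡_ f × (∀ i → f i ≢ x × ¬ Clash x (f i))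

  star-colours : ∀ {x d} → Star x d → Σ (Fin d → Fin 6) λ g → Injective _≡_ _≡_ g ×
                 (∀ {c} → Misses x c → ∀ i → c ≢ g i)
  star-colours {x} (f , f-inj , f-adj) =
    (λ i → colour (edge i)) , g-inj , λ misses i eq → misses _ (edge i) (sym eq)
    where
    decode-injective : ∀ {x y} → decode x ≈ᵛ decode y → x ≡ y
    decode-injective eq = trans (sym (encode-decode _)) (trans (encode-cong eq) (encode-decode _))
    edge : ∀ i → decode x ~ decode (f i)
    edge i = ¬Clash⇒~ (λ eq → proj₁ (f-adj i) (sym (decode-injective eq)))
      (subst₂ (λ x y → ¬ Clash x y) (sym (encode-decode x)) (sym (encode-decode (f i))) (proj₂ (f-adj i)))
    g-inj : Injective _≡_ _≡_ (λ i → colour (edge i))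
    g-inj {i} {j} eq with i Fin.≟ j
    ... | yes i≡j = i≡j
    ... | no i≢j  = contradiction eq (proper (edge i) (edge j) (i≢j ∘ f-inj ∘ decode-injective))

  star-6 : ∀ {x c} → Star x 6 → ¬ Misses x c
  star-6 star misses with star-colours star
  ... | g , g-inj , avoids = Fin.<⇒notInjective {f = λ i → Fin.punchOut (avoids misses i)} ≤-refl
    λ {i} {j} eq → g-inj (Fin.punchOut-injective (avoids misses i) (avoids misses j) eq)

  star-5 : ∀ {x c c′} → Star x 5 → Misses x c → Misses x c′ → c ≡ c′
  star-5 {c = c} {c′} star misses misses′ with c Fin.≟ c′ | star-colours star
  ... | yes c≡c′ | _ = c≡c′
  ... | no c≢c′  | g , g-inj , avoids = contradiction
    (λ {i} {j} eq → g-inj (Fin.punchOut-injective (avoids misses i) (avoids misses j)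
      (Fin.punchOut-injective (c′≢ i) (c′≢ j) eq)))
    (Fin.<⇒notInjective {f = λ i → Fin.punchOut (c′≢ i)} ≤-refl)
    where
    c′≢ : ∀ i → Fin.punchOut c≢c′ ≢ Fin.punchOut (avoids misses i)
    c′≢ i eq = avoids misses′ i (Fin.punchOut-injective c≢c′ (avoids misses i) eq)

  centre-star : ∀ l → Star (centre l) 6
  centre-star l = vertexAt ∘ Fin.punchIn (vertexIndex x) ,
    (λ eq → Fin.punchIn-injective (vertexIndex x) _ _ (vertexAt-injective eq)) ,
    (λ i → (λ eq → Fin.punchInᵢ≢i (vertexIndex x) i
      (trans (sym (vertexIndex-at {2} {2} {3} _)) (cong vertexIndex eq))) , λ ())
    where
    x : Vertex 2 2 3
    x = centre l
    vertexAt-injective : ∀ {i j : Fin 7} → vertexAt {2} {2} {3} i ≡ vertexAt j → i ≡ j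
    vertexAt-injective eq = trans (sym (vertexIndex-at {2} {2} {3} _))
      (trans (cong vertexIndex eq) (vertexIndex-at {2} {2} {3} _))

  outer : Fin 4 → Vertex 2 2 3
  outer = inj₁ ∘ Fin.splitAt 2

  outer-star : ∀ k → Star (outer k) 5
  outer-star k = star (Fin.splitAt 2 k)
    where
    splitAt-injective : ∀ {i j : Fin 5} → Fin.splitAt 2 i ≡ Fin.splitAt 2 j → i ≡ j
    splitAt-injective {i} {j} eq = trans (sym (Fin.join-splitAt 2 3 i))
      (trans (cong (Fin.join 2 3) eq) (Fin.join-splitAt 2 3 j))
    toRight toLeft : Fin 2 ⊎ Fin 3 → Vertex 2 2 3
    toRight = [ (λ j → right j) , (λ l → centre l) ]
    toLeft  = [ (λ i → left i) , (λ l → centre l) ]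
    toRight-injective : ∀ {y z} → toRight y ≡ toRight z → y ≡ z
    toRight-injective {inj₁ _} {inj₁ _} refl = refl
    toRight-injective {inj₂ _} {inj₂ _} refl = refl
    toLeft-injective : ∀ {y z} → toLeft y ≡ toLeft z → y ≡ z
    toLeft-injective {inj₁ _} {inj₁ _} refl = refl
    toLeft-injective {inj₂ _} {inj₂ _} refl = refl
    toRight-adjacent : ∀ i y → toRight y ≢ left i × ¬ Clash (left i) (toRight y)
    toRight-adjacent i (inj₁ _) = (λ ()) , λ ()
    toRight-adjacent i (inj₂ _) = (λ ()) , λ ()
    toLeft-adjacent : ∀ j y → toLeft y ≢ right j × ¬ Clash (right j) (toLeft y)
    toLeft-adjacent j (inj₁ _) = (λ ()) , λ ()
    toLeft-adjacent j (inj₂ _) = (λ ()) , λ ()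
    star : ∀ x → Star (inj₁ x) 5
    star (inj₁ i) = toRight ∘ Fin.splitAt 2 , splitAt-injective ∘ toRight-injective ,
      toRight-adjacent i ∘ Fin.splitAt 2
    star (inj₂ j) = toLeft ∘ Fin.splitAt 2 , splitAt-injective ∘ toLeft-injective ,
      toLeft-adjacent j ∘ Fin.splitAt 2

  outer-missed : ∀ c → ∃ λ k → Misses (outer k) c
  outer-missed c = conclude (missed-vertex c)
    where
    conclude : (∃ λ x → Misses x c) → ∃ λ k → Misses (outer k) c
    conclude (centre l , misses) = contradiction misses (star-6 (centre-star l))
    conclude (inj₁ x , misses)   = Fin.join 2 2 x ,
      subst (λ y → Misses (inj₁ y) c) (sym (Fin.splitAt-join 2 2 x)) misses

  impossible : ⊥
  impossible = conclude outer-missed (λ f → Fin.pigeonhole {4} {6} (m≤m+n 5 1) f)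
    where
    conclude : (∀ c → ∃ λ k → Misses (outer k) c) →
               (∀ (f : Fin 6 → Fin 4) → ∃₂ λ c c′ → c Fin.< c′ × f c ≡ f c′) → ⊥
    conclude miss hole = let c , c′ , c<c′ , same = hole (proj₁ ∘ miss) in
      Fin.<⇒≢ c<c′ (star-5 (outer-star (proj₁ (miss c))) (proj₂ (miss c))
        (subst (λ k → Misses (outer k) c′) (sym same) (proj₂ (miss c′))))

placement-≤ : ∀ {u₀ v₀ p} → u₀ ≤ v₀ → 1 ≤ u₀ + v₀ →
              suc (suc u₀) + u₀ + (suc (suc v₀) + v₀) + p ≡ suc (suc (half u₀ v₀) * 2) →
              Placement (suc (suc u₀) + u₀) (suc (suc v₀) + v₀) p (half u₀ v₀)
placement-≤ {u₀} u₀≤v₀ nontrivial with m≤n⇒∃[o]m+o≡n u₀≤v₀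
... | d , refl = Parameters.placement u₀ d (positive u₀ nontrivial)
  where
  positive : ∀ u {d} → 1 ≤ u + (u + d) → 1 ≤ u + d
  positive zero    1≤d = 1≤d
  positive (suc _) _   = s≤s z≤n

-- The construction wants the smaller class on the left; exchanging the two outer classes preserves
-- clashes and settles the other order.
placement-exists : ∀ u₀ v₀ {p} → 1 ≤ u₀ + v₀ →
  suc (suc u₀) + u₀ + (suc (suc v₀) + v₀) + p ≡ suc (suc (half u₀ v₀) * 2) →
  Placement (suc (suc u₀) + u₀) (suc (suc v₀) + v₀) p (half u₀ v₀)
placement-exists u₀ v₀ {p} nontrivial count with ≤-total u₀ v₀
... | inj₁ u₀≤v₀ = placement-≤ u₀≤v₀ nontrivial count
... | inj₂ v₀≤u₀ = subst (Placement _ _ p) (half-comm v₀ u₀) (swapPlacement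
  (placement-≤ v₀≤u₀ (subst (1 ≤_) (+-comm u₀ v₀) nontrivial)
    (trans (cong (_+ p) (+-comm (suc (suc v₀) + v₀) _))
      (trans count (cong (λ m → suc (suc m * 2)) (half-comm u₀ v₀))))))

vertex-count : ∀ u v → suc (suc u) + u + suc (suc v + v) + (suc v + v + (suc u + u) * suc (suc v + v)) ≡
                suc (suc (2 * (suc u * suc v) + (u + v)) * 2)
vertex-count = solve-∀

module _ {v e a} (G : SimpleGraph v e a) where
  open SimpleGraph G using (vertices)

  more-colours : ∀ {j k} → j ≤ k → EdgeColouring G j → EdgeColouring G k
  more-colours j≤k colouring = record
    { colour      = λ p → Fin.inject≤ (colour p) j≤k
    ; colour-cong = λ x≈ y≈ p q → cong (λ c → Fin.inject≤ c j≤k) (colour-cong x≈ y≈ p q)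
    ; colour-sym  = λ p → cong (λ c → Fin.inject≤ c j≤k) (colour-sym p)
    ; proper      = λ p q y≉z eq → proper p q y≉z (Fin.inject≤-injective j≤k j≤k _ _ eq)
    }
    where open EdgeColouring colouring

  smallest⇒Class2 : Represents G 2 2 3 → Class2 G
  smallest⇒Class2 rep = 6 , dominating⇒IsMaxDegree G enumeration ~-dec (centre-~ zero) ,
    cyclic-colouring G enumeration ,
    λ j colouring → ≰⇒> λ j≤6 → SixColours.impossible G rep (more-colours j≤6 colouring)
    where open Represented G rep

  -- A centre vertex is adjacent to all 2m others, so Δ is at least 2m, while 2m colours suffice; Δ
  -- + 1 is then not minimal. Writing `suc p` provides the centre vertex.
  placement⇒¬Class2 : ∀ {s t p m′} → Represents G s t (suc p) → s + t + suc p ≡ suc (suc m′ * 2) →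
                      Placement s t (suc p) m′ → ¬ Class2 G
  placement⇒¬Class2 rep vertex-count π (Δ , maxDegree , _ , minimal) =
    <⇒≱ (minimal _ (placed-colouring π))
      (dominating⇒≤Δ G (subst (HasSize vertices) vertex-count enumeration) (centre-~ zero) maxDegree)
    where open Represented G rep

  Class2⇔ : ∀ u₀ v₀ → let s₀ = suc u₀ + u₀; t₀ = suc v₀ + v₀ in
            Represents G (suc s₀) (suc t₀) (t₀ + s₀ * suc t₀) →
            Class2 G ⇔ (suc s₀ ≡ 2 × suc t₀ ≡ 2)
  Class2⇔ u₀ v₀ rep = mk⇔ (forth u₀ v₀ rep) (back u₀ v₀ rep)
    where
    forth : ∀ u₀ v₀ → let s₀ = suc u₀ + u₀; t₀ = suc v₀ + v₀ in
            Represents G (suc s₀) (suc t₀) (t₀ + s₀ * suc t₀) → Class2 G → suc s₀ ≡ 2 × suc t₀ ≡ 2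
    forth zero     zero     _ _ = refl , refl
    forth zero     (suc v₀) rep class2 = contradiction class2 (placement⇒¬Class2 rep (vertex-count 0 (suc v₀))
      (placement-exists 0 (suc v₀) (s≤s z≤n) (vertex-count 0 (suc v₀))))
    forth (suc u₀) v₀       rep class2 = contradiction class2 (placement⇒¬Class2 rep (vertex-count (suc u₀) v₀)
      (placement-exists (suc u₀) v₀ (s≤s z≤n) (vertex-count (suc u₀) v₀)))
    back : ∀ u₀ v₀ → let s₀ = suc u₀ + u₀; t₀ = suc v₀ + v₀ in
           Represents G (suc s₀) (suc t₀) (t₀ + s₀ * suc t₀) → suc s₀ ≡ 2 × suc t₀ ≡ 2 → Class2 G
    back zero zero rep _ = smallest⇒Class2 rep

-- The essential annihilating-ideal graph of a product of local rings

module Coding {s₀ t₀ : ℕ} (zˡ : Fin (suc s₀)) (zʳ : Fin (suc t₀)) where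

  s t p : ℕ
  s = suc s₀
  t = suc t₀
  p = t₀ + s₀ * t

  Code : Set
  Code = Maybe (Fin s) × Maybe (Fin t)

  -- The excluded codes are those of the whole ring and of the zero ideal, the only ideals that are
  -- not vertices.
  Valid : Code → Set
  Valid c = c ≢ (nothing , nothing) × c ≢ (just zˡ , just zʳ)

  -- Pairs of proper ideals are numbered by `Fin (s * t)`, and `suc p` reduces to `s * t`; the
  -- number of the zero ideal is skipped to enumerate the centre.
  hole : Fin (suc p)
  hole = Fin.combine zˡ zʳ

  justs : Fin s × Fin t → Code
  justs (i , j) = just i , just j

  justs-injective : ∀ {x y} → justs x ≡ justs y → x ≡ y
  justs-injective refl = refl

  toCode : Vertex s t p → Code
  toCode (left i)   = just i , nothing
  toCode (right j)  = nothing , just j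
  toCode (centre l) = justs (Fin.remQuot {s} t (Fin.punchIn hole l))

  remQuot-injective : ∀ {x y} → Fin.remQuot {s} t x ≡ Fin.remQuot {s} t y → x ≡ y
  remQuot-injective {x} {y} eq = trans (sym (Fin.combine-remQuot {s} t x))
    (trans (cong (λ (i , j) → Fin.combine i j) eq) (Fin.combine-remQuot {s} t y))

  toCode-valid : ∀ x → Valid (toCode x)
  toCode-valid (left i)   = (λ ()) , λ ()
  toCode-valid (right j)  = (λ ()) , λ ()
  toCode-valid (centre l) = (λ ()) , λ eq → Fin.punchInᵢ≢i hole l (remQuot-injective
    (trans (justs-injective eq) (sym (Fin.remQuot-combine zˡ zʳ))))

  toCode-injective : ∀ {x y} → toCode x ≡ toCode y → x ≡ y
  toCode-injective {left _}   {left _}   refl = refl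
  toCode-injective {right _}  {right _}  refl = refl
  toCode-injective {centre _} {centre _} eq   =
    cong inj₂ (Fin.punchIn-injective hole _ _ (remQuot-injective (justs-injective eq)))
  toCode-injective {left _}   {right _}  ()
  toCode-injective {left _}   {centre _} ()
  toCode-injective {right _}  {left _}   ()
  toCode-injective {right _}  {centre _} ()
  toCode-injective {centre _} {left _}   ()
  toCode-injective {centre _} {right _}  ()

  fromCode : ∀ c → Valid c → ∃ λ x → toCode x ≡ c
  fromCode (nothing , nothing) (¬R , _) = contradiction refl ¬R
  fromCode (just i  , nothing) _        = left i , refl
  fromCode (nothing , just j)  _        = right j , refl
  fromCode (just i  , just j)  (_ , ¬0) = centre (Fin.punchOut hole≢) ,
    cong justs (trans (cong (Fin.remQuot {s} t) (Fin.punchIn-punchOut hole≢)) (Fin.remQuot-combine i j))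
    where
    hole≢ : hole ≢ Fin.combine i j
    hole≢ eq with Fin.combine-injective zˡ zʳ i j eq
    ... | refl , refl = ¬0 refl

  BothNothing : Code → Code → Set
  BothNothing (a , b) (a′ , b′) = (a ≡ nothing × a′ ≡ nothing) ⊎ (b ≡ nothing × b′ ≡ nothing)

  Clash⇒BothNothing : ∀ x y → Clash x y → BothNothing (toCode x) (toCode y)
  Clash⇒BothNothing (left _)  (left _)  _ = inj₂ (refl , refl)
  Clash⇒BothNothing (right _) (right _) _ = inj₁ (refl , refl)

  BothNothing⇒Clash : ∀ x y → BothNothing (toCode x) (toCode y) → Clash x y
  BothNothing⇒Clash (left _)   (left _)   _ = Unit.tt
  BothNothing⇒Clash (right _)  (right _)  _ = Unit.tt
  BothNothing⇒Clash (left _)   (right _)  (inj₁ (() , _))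
  BothNothing⇒Clash (left _)   (right _)  (inj₂ (_ , ()))
  BothNothing⇒Clash (left _)   (centre _) (inj₁ (() , _))
  BothNothing⇒Clash (left _)   (centre _) (inj₂ (_ , ()))
  BothNothing⇒Clash (right _)  (left _)   (inj₁ (_ , ()))
  BothNothing⇒Clash (right _)  (left _)   (inj₂ (() , _))
  BothNothing⇒Clash (right _)  (centre _) (inj₁ (_ , ()))
  BothNothing⇒Clash (right _)  (centre _) (inj₂ (() , _))
  BothNothing⇒Clash (centre _) _          (inj₁ (() , _))
  BothNothing⇒Clash (centre _) _          (inj₂ (() , _))

module _ {c ℓ} (R₁ R₂ : CommutativeRing c ℓ) {s₀ t₀ : ℕ}
  (artinian₁ : IsArtinian R₁) (local₁ : IsLocal R₁) (size₁ : HasSize (properIdealSetoid R₁) (suc s₀))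
  (artinian₂ : IsArtinian R₂) (local₂ : IsLocal R₂) (size₂ : HasSize (properIdealSetoid R₂) (suc t₀)) where

  open Product R₁ R₂
  open LocalProduct R₁ R₂ artinian₁ local₁ size₁ artinian₂ local₂ size₂
  open Coding L₁.0-code L₂.0-code
  open SimpleGraph (𝓔𝓖 R) using (V)

  codeOf : Ideal R → Code
  codeOf I = L₁.code (factorˡ I) , L₂.code (factorʳ I)

  codeOf-cong : ∀ I J → I ≈ᴵ J → codeOf I ≡ codeOf J
  codeOf-cong I J (I⊆J , J⊆I) = cong₂ _,_
    (L₁.code-cong {factorˡ I} {factorˡ J} (I⊆J , J⊆I))
    (L₂.code-cong {factorʳ I} {factorʳ J} (I⊆J , J⊆I))

  codeOf-injective : ∀ I J → codeOf I ≡ codeOf J → I ≈ᴵ J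
  codeOf-injective I J eq = factors-injective I J
    (L₁.code-injective {factorˡ I} {factorˡ J} (cong proj₁ eq))
    (L₂.code-injective {factorʳ I} {factorʳ J} (cong proj₂ eq))

  codeOf-0ᴵ : codeOf 0ᴵ ≡ (just L₁.0-code , just L₂.0-code)
  codeOf-0ᴵ = cong₂ _,_
    (trans (L₁.code-cong {factorˡ 0ᴵ} {0ᴵ}
      ((λ p → lift (proj₁ (lower p))) , λ p → lift (lower p , R₂.refl))) L₁.code-0ᴵ)
    (trans (L₂.code-cong {factorʳ 0ᴵ} {0ᴵ}
      ((λ p → lift (proj₂ (lower p))) , λ p → lift (R₁.refl , lower p))) L₂.code-0ᴵ)
    where
    module R₁ = CommutativeRing R₁
    module R₂ = CommutativeRing R₂

  vertex-valid : ((I , _) : V) → Valid (codeOf I)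
  vertex-valid (I , Ann≠0 , I≠0) =
    (λ eq → Ann-zero I (L₁.code≡nothing⁻¹ {factorˡ I} (cong proj₁ eq))
              (L₂.code≡nothing⁻¹ {factorʳ I} (cong proj₂ eq)) Ann≠0) ,
    λ eq → I≠0 (codeOf-injective I 0ᴵ (trans eq (sym codeOf-0ᴵ)))

  -- An ideal other than the whole ring has a proper factor, and one proper factor already gives a
  -- non-zero annihilator.
  valid-vertex : (I : Ideal R) → Valid (codeOf I) → V
  valid-vertex I (≢R , ≢0) = I , Ann≠0 , λ I≈0 → ≢0 (trans (codeOf-cong I 0ᴵ I≈0) codeOf-0ᴵ)
    where
    Ann≠0 : IsNonZero (Ann I)
    Ann≠0 = [ Ann-nonZeroˡ I , Ann-nonZeroʳ I ] (¬both (L₁.classical (Unitalˡ I)))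
      where
      ¬both : Dec (Unitalˡ I) → ¬ Unitalˡ I ⊎ ¬ Unitalʳ I
      ¬both (no properˡ)  = inj₁ properˡ
      ¬both (yes unitalˡ) = inj₂ λ unitalʳ →
        ≢R (cong₂ _,_ (L₁.code≡nothing {factorˡ I} unitalˡ) (L₂.code≡nothing {factorʳ I} unitalʳ))

  represents : Represents (𝓔𝓖 R) s t p
  represents = record
    { encode           = encode
    ; decode           = decode
    ; encode-cong      = λ {x} {y} x≈y → toCode-injective (trans (toCode-encode x)
        (trans (codeOf-cong (proj₁ x) (proj₁ y) x≈y) (sym (toCode-encode y))))
    ; encode-injective = λ {x} {y} eq → codeOf-injective (proj₁ x) (proj₁ y)
        (trans (sym (toCode-encode x)) (trans (cong toCode eq) (toCode-encode y)))
    ; encode-decode    = λ x → toCode-injective (trans (toCode-encode (decode x)) (codeOf-idealAt (toCode x)))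
    ; ~⇒¬Clash         = λ {x} {y} (_ , ess) clash → clash-free x y
        (essential⇒¬Unital (proj₁ x) (proj₁ y) ess)
        (subst₂ BothNothing (toCode-encode x) (toCode-encode y) (Clash⇒BothNothing (encode x) (encode y) clash))
    ; ¬Clash⇒~         = λ {x} {y} x≉y ¬clash → x≉y , ¬Unital⇒essential (proj₁ x) (proj₁ y)
        (λ (f , g) → ¬clash (BothNothing⇒Clash (encode x) (encode y)
          (subst₂ BothNothing (sym (toCode-encode x)) (sym (toCode-encode y))
            (inj₁ (L₁.code≡nothing {factorˡ (proj₁ x)} f , L₁.code≡nothing {factorˡ (proj₁ y)} g)))))
        (λ (f , g) → ¬clash (BothNothing⇒Clash (encode x) (encode y)
          (subst₂ BothNothing (sym (toCode-encode x)) (sym (toCode-encode y))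
            (inj₂ (L₂.code≡nothing {factorʳ (proj₁ x)} f , L₂.code≡nothing {factorʳ (proj₁ y)} g)))))
    }
    where
    encode : V → Vertex s t p
    encode x = proj₁ (fromCode (codeOf (proj₁ x)) (vertex-valid x))
    toCode-encode : ∀ x → toCode (encode x) ≡ codeOf (proj₁ x)
    toCode-encode x = proj₂ (fromCode (codeOf (proj₁ x)) (vertex-valid x))
    idealAt : Code → Ideal R
    idealAt (a , b) = L₁.decode a ×ᴵ L₂.decode b
    codeOf-idealAt : ∀ c → codeOf (idealAt c) ≡ c
    codeOf-idealAt (a , b) = cong₂ _,_
      (trans (L₁.code-cong {factorˡ (idealAt (a , b))} {L₁.decode a}
        (factorˡ-× (L₁.decode a) (L₂.decode b))) (L₁.code-decode a))
      (trans (L₂.code-cong {factorʳ (idealAt (a , b))} {L₂.decode b}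
        (factorʳ-× (L₁.decode a) (L₂.decode b))) (L₂.code-decode b))
    decode : Vertex s t p → V
    decode x = valid-vertex (idealAt (toCode x))
      (subst Valid (sym (codeOf-idealAt (toCode x))) (toCode-valid x))
    clash-free : ∀ x y → let I = proj₁ x; J = proj₁ y in
                 ¬ (Unitalˡ I × Unitalˡ J) × ¬ (Unitalʳ I × Unitalʳ J) → ¬ BothNothing (codeOf I) (codeOf J)
    clash-free x y (¬ˡ , _) (inj₁ (f , g)) =
      ¬ˡ (L₁.code≡nothing⁻¹ {factorˡ (proj₁ x)} f , L₁.code≡nothing⁻¹ {factorˡ (proj₁ y)} g)
    clash-free x y (_ , ¬ʳ) (inj₂ (f , g)) =
      ¬ʳ (L₂.code≡nothing⁻¹ {factorʳ (proj₁ x)} f , L₂.code≡nothing⁻¹ {factorʳ (proj₁ y)} g)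

even-≥2 : ∀ {t} → 2 ≤ t → 2 ∣ t → ∃ λ u → t ≡ suc (suc u) + u
even-≥2 () (divides zero refl)
even-≥2 2≤t (divides (suc u) refl) = u , identity u
  where
  identity : ∀ u → suc u * 2 ≡ suc (suc u) + u
  identity = solve-∀

theorem2p7 : ∀ {c ℓ} (R₁ R₂ : CommutativeRing c ℓ) (t₁ t₂ : ℕ) →
    IsArtinian R₁ → IsLocal R₁ → HasSize (properIdealSetoid R₁) t₁ → 2 ≤ t₁ → 2 ∣ t₁ →
    IsArtinian R₂ → IsLocal R₂ → HasSize (properIdealSetoid R₂) t₂ → 2 ≤ t₂ → 2 ∣ t₂ →
    Class2 (𝓔𝓖 (commutativeRing R₁ R₂)) ⇔ (t₁ ≡ 2 × t₂ ≡ 2)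
theorem2p7 R₁ R₂ t₁ t₂ artinian₁ local₁ size₁ 2≤t₁ 2∣t₁ artinian₂ local₂ size₂ 2≤t₂ 2∣t₂
  with even-≥2 2≤t₁ 2∣t₁ | even-≥2 2≤t₂ 2∣t₂
... | u₀ , refl | v₀ , refl = Class2⇔ (𝓔𝓖 (commutativeRing R₁ R₂)) u₀ v₀
  (represents R₁ R₂ artinian₁ local₁ size₁ artinian₂ local₂ size₂)
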